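{- Let $m\le n$ and $k\ge 1$. Suppose that for every 1D array of size $n$ there is an $S(n,k)$-bit encoding from which sorted 2-sided Top-$k$ queries can be answered. Then every $m\times n$ array $A$ admits an encoding of $mS(n,k)+2nm(m-1)$ bits from which every sorted 4-sided Top-$k$ query on $A$ can be answered. In particular, using a $(\lg\binom{(k+1)n}{n}+o(n))$-bit encoding for sorted 2-sided Top-$k$ queries on 1D arrays, one obtains an encoding of $m\lg\binom{(k+1)n}{n}+2nm(m-1)+o(n)$ bits for sorted 4-sided Top-$k$ queries on $m\times n$ arrays.
   Context: All arrays have pairwise distinct entries from a totally ordered set. For a 1D array $B[1..n]$ and $1\le i\le j\le n$, the query Top-$k(i,j,B)$ returns the positions of the $k$ largest values of $B[i..j]$ (all positions if it has at most $k$ entries); a query is sorted if the positions must be reported in decreasing order of their values; 2-sided queries allow arbitrary $i\le j$. For an $m\times n$ array $A$, Top-$k(i,j,a,b,A)$ (with $1\le i\le j\le m$, $1\le a\le b\le n$) returns the positions of the $k$ largest values in the subarray $A[i..j][a..b]$; 4-sided queries allow arbitrary such $i,j,a,b$. An $s$-bit encoding supporting a family of queries is a map assigning to each array a bit string of length at most $s$ such that every query of the family can be answered from this bit string alone, without access to the array. -}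

module Defs where

open import Level using (Level; _⊔_)
open import Data.Bool.Base using (Bool)
open import Data.Fin.Base as Fin using (Fin)
open import Data.Fin.Properties using (_≤?_)
open import Data.List.Base using (List; length; filter; allFin; cartesianProduct)
open import Data.List.Membership.Propositional using (_∈_; _∉_)
open import Data.List.Relation.Unary.All using (All)
open import Data.List.Relation.Unary.AllPairs using (AllPairs)
open import Data.Nat.Base using (ℕ; _*_; _^_; _≤_; _⊓_)
open import Data.Product.Base using (_×_; _,_; ∃; ∃₂)
open import Function.Definitions using (Injective)
open import Relation.Binary.Bundles using (TotalOrder)
open import Relation.Binary.PropositionalEquality using (_≡_)
open import Relation.Nullary.Decidable using (_×-dec_)
import Relation.Binary.Properties.TotalOrder as TotalOrderProperties

-- An s-bit encoding: `decode` sees only the bit string and the query.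
record Encoding {a q r ℓ} (Array : Set a) (Query : Set q) (Answer : Set r)
                (Answers : Array → Query → Answer → Set ℓ)
                (s : ℕ) : Set (a ⊔ q ⊔ r ⊔ ℓ) where
  field
    encode        : Array → List Bool
    encode-length : ∀ A → length (encode A) ≤ s
    decode        : List Bool → Query → Answer
    correct       : ∀ A x → Answers A x (decode (encode A) x)

Range : ℕ → Set
Range n = ∃₂ λ (i j : Fin n) → i Fin.≤ j

positions : ∀ {n} → Range n → List (Fin n)
positions {n} (i , j , _) = filter (λ p → (i ≤? p) ×-dec (p ≤? j)) (allFin n)

positions₂ : ∀ {m n} → Range m × Range n → List (Fin m × Fin n)
positions₂ (rows , columns) = cartesianProduct (positions rows) (positions columns)

module TopK {c ℓ₁ ℓ₂ : Level} (O : TotalOrder c ℓ₁ ℓ₂) where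

  open TotalOrder O using (Carrier; _≈_)
  open TotalOrderProperties O using (_<_)

  record Array (Pos : Set) : Set (c ⊔ ℓ₁) where
    field
      value    : Pos → Carrier
      distinct : Injective _≡_ _≈_ value

  open Array

  -- `ans` lists the positions of the k largest values among the positions of
  -- the duplicate-free list `region`, in decreasing order of value.
  record IsSortedTopK {Pos : Set} (k : ℕ) (A : Array Pos)
                      (region ans : List Pos) : Set (ℓ₁ ⊔ ℓ₂) where
    field
      inside     : All (_∈ region) ans
      size       : length ans ≡ k ⊓ length region
      largest    : ∀ {p q} → p ∈ ans → q ∈ region → q ∉ ans → value A q < value A p
      decreasing : AllPairs (λ p q → value A q < value A p) ans

  SortedEncoding₁ : (n k s : ℕ) → Set (c ⊔ ℓ₁ ⊔ ℓ₂)
  SortedEncoding₁ n k s =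
    Encoding (Array (Fin n)) (Range n) (List (Fin n))
             (λ B x → IsSortedTopK k B (positions x)) s

  SortedEncoding₂ : (m n k s : ℕ) → Set (c ⊔ ℓ₁ ⊔ ℓ₂)
  SortedEncoding₂ m n k s =
    Encoding (Array (Fin m × Fin n)) (Range m × Range n) (List (Fin m × Fin n))
             (λ A x → IsSortedTopK k A (positions₂ x)) s

-- s ≤ m · lg x + e for real lg x (x ≥ 1), exponentiated so that it lives in ℕ.
_≤_·lg_+_ : (s m x e : ℕ) → Set
s ≤ m ·lg x + e = 2 ^ s ≤ x ^ m * 2 ^ e

-- g = o(n), with ε ranging over the reciprocals 1/d.  Natural-valued g suffice
-- for bounds on lengths, since |g| can be rounded up when g = o(n).
IsLittleO-n : (ℕ → ℕ) → Set
IsLittleO-n g = ∀ d → 1 ≤ d → ∃ λ N → ∀ n → N ≤ n → d * g n ≤ n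

{-# OPTIONS --safe #-}
module Submission where

open import Defs
open import Data.Nat.Base using (ℕ; zero; suc; _+_; _*_; _∸_; _^_; _⊓_; _⊔_; _≤_; _<_; z≤n; s≤s)
open import Data.Nat.Combinatorics using (_C_)
open import Data.Product.Base using (_×_; _,_; ∃; ∃₂; proj₁; proj₂; map₁)
open import Relation.Binary.Bundles using (TotalOrder)
open import Level using (Level) renaming (_⊔_ to _⊔ˡ_)
open import Data.Bool.Base using (Bool; true; false)
open import Data.Bool.Properties using () renaming (_≟_ to _≟ᵇ_)
open import Data.Empty using (⊥-elim)
open import Data.Fin.Base as Fin using (Fin; toℕ)
open import Data.Fin.Properties as Fin using ()
open import Data.List.Base using (List; []; _∷_; _++_; length; filter; map; allFin; cartesianProduct; cartesianProductWith; upTo; take; drop; replicate)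
open import Data.List.Extrema.Nat using (argmin; argmax; argmin-all; argmax-all; f[xs]≤f[argmax]; f[argmin]≤f[xs])
open import Data.List.Membership.Propositional using (_∈_; _∉_; find; lose)
open import Data.List.Membership.Propositional.Properties using (∈-∃++; ∈-++⁻; ∈-++⁺ˡ; ∈-++⁺ʳ; ∈-map⁺; ∈-map⁻; ∈-filter⁺; ∈-filter⁻; ∈-allFin; ∈-upTo⁺; ∈-cartesianProduct⁺; ∈-cartesianProduct⁻; ∈-cartesianProductWith⁺)
import Data.List.Membership.DecPropositional as DecMembership
open import Data.List.Properties using (length-++; length-map; length-replicate; length-tabulate)
open import Data.List.Relation.Binary.Subset.Propositional using (_⊆_)
open import Data.List.Relation.Unary.All as All using (All; []; _∷_)
open import Data.List.Relation.Unary.All.Properties as All using ()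
open import Data.List.Relation.Unary.AllPairs as AllPairs using (AllPairs; []; _∷_)
open import Data.List.Relation.Unary.AllPairs.Properties as AllPairs using ()
open import Data.List.Relation.Unary.Any as Any using (Any; here; there)
open import Data.List.Relation.Unary.Unique.Propositional using (Unique)
open import Data.List.Relation.Unary.Unique.Propositional.Properties using (Unique[x∷xs]⇒x∉xs) renaming (filter⁺ to unique-filter⁺; allFin⁺ to unique-allFin; cartesianProduct⁺ to unique-cartesianProduct⁺)
open import Data.Nat.Properties renaming (_≟_ to _≟ⁿ_)
open import Data.Nat.Tactic.RingSolver using (solve-∀)
open import Data.Product.Properties using (≡-dec)
open import Data.Sum.Base as Sum using (_⊎_; inj₁; inj₂; [_,_]′)
open import Data.Vec.Base as Vec using (Vec)
open import Data.Vec.Properties using (lookup∘tabulate)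
open import Data.Vec.Relation.Unary.All as VecAll using ([]; _∷_) renaming (All to VecAll)
open import Data.Vec.Relation.Unary.All.Properties as VecAll using ()
open import Function.Base using (_∘_; id)
open import Function.Definitions using (Injective)
open import Relation.Binary.Core using (Rel)
open import Relation.Binary.Definitions using (DecidableEquality; Irreflexive)
open import Relation.Binary.PropositionalEquality
import Relation.Binary.Properties.TotalOrder as TotalOrderProperties
open import Relation.Nullary
open import Relation.Unary using (Decidable)

-- Consider the set 𝒞 of all matrices of ranks that agree with the answers
-- encoded for the single rows.  The extra bits shrink 𝒞: each one compares two
-- positions of different rows, chosen as a function of 𝒞 alone, so that a
-- decoder can replay the choices.  Call a pair of rows over an interval of
-- columns resolved if all members of 𝒞 have the same sorted Top-k there.  If it
-- is not, then below their common prefix all members of 𝒞 have the same best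
-- remaining position in either row, and 𝒞 does not settle which of the two wins.
--
-- A comparison is charged to its winner, the row of its loser and the side of
-- the winner on which the loser lies.  If for a pair of rows one always
-- compares the heads of a run of unresolved intervals such that every other
-- unresolved interval containing the left head ends no later than the run, and
-- every one containing the right head starts no earlier, then no charge is used
-- twice.  Hence at most 2nm(m − 1) comparisons resolve all pairs of rows, and these
-- determine all sorted Top-k answers.

private variable
  a b ℓ ℓ′ : Level
  A : Set a
  B : Set b

-- Duplicate-free lists and sorted Top-k lists

unique-⊆⇒length≤ : {xs ys : List A} → Unique xs → xs ⊆ ys → length xs ≤ length ys
unique-⊆⇒length≤ {xs = []} _ _ = z≤n
unique-⊆⇒length≤ {xs = x ∷ xs} u@(_ ∷ uxs) xs⊆ys with ∈-∃++ (xs⊆ys (here refl))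
... | as , bs , refl = begin
  suc (length xs)              ≤⟨ s≤s (unique-⊆⇒length≤ uxs xs⊆as++bs) ⟩
  suc (length (as ++ bs))      ≡⟨ cong suc (length-++ as) ⟩
  suc (length as + length bs)  ≡⟨ +-suc (length as) (length bs) ⟨
  length as + suc (length bs)  ≡⟨ length-++ as ⟨
  length (as ++ x ∷ bs)        ∎
  where
  open ≤-Reasoning
  xs⊆as++bs : xs ⊆ as ++ bs
  xs⊆as++bs y∈xs with ∈-++⁻ as (xs⊆ys (there y∈xs))
  ... | inj₁ y∈as         = ∈-++⁺ˡ y∈as
  ... | inj₂ (here refl)  = ⊥-elim (Unique[x∷xs]⇒x∉xs u y∈xs)
  ... | inj₂ (there y∈bs) = ∈-++⁺ʳ as y∈bs

length-cartesianProduct : (xs : List A) (ys : List B) →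
                          length (cartesianProduct xs ys) ≡ length xs * length ys
length-cartesianProduct []       ys = refl
length-cartesianProduct (x ∷ xs) ys = begin
  length (map (x ,_) ys ++ cartesianProduct xs ys)          ≡⟨ length-++ (map (x ,_) ys) ⟩
  length (map (x ,_) ys) + length (cartesianProduct xs ys)  ≡⟨ cong₂ _+_ (length-map (x ,_) ys) (length-cartesianProduct xs ys) ⟩
  length ys + length xs * length ys                         ∎
  where open ≡-Reasoning

AllPairs-lookup : {R : Rel A ℓ} {xs : List A} {x y : A} → AllPairs R xs →
                  x ∈ xs → y ∈ xs → x ≡ y ⊎ R x y ⊎ R y x
AllPairs-lookup (_  ∷ _)  (here refl)  (here refl)  = inj₁ refl
AllPairs-lookup (rs ∷ _)  (here refl)  (there y∈xs) = inj₂ (inj₁ (All.lookup rs y∈xs))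
AllPairs-lookup (rs ∷ _)  (there x∈xs) (here refl)  = inj₂ (inj₂ (All.lookup rs x∈xs))
AllPairs-lookup (_  ∷ ps) (there x∈xs) (there y∈xs) = AllPairs-lookup ps x∈xs y∈xs

-- The conditions of `IsSortedTopK` over an arbitrary relation, so that one answer list can be
-- tested against the order of the array and the rank order of each candidate.
record SortedTop {Pos : Set} (_≺_ : Rel Pos ℓ) (k : ℕ) (region ans : List Pos) : Set ℓ where
  field
    inside     : All (_∈ region) ans
    size       : length ans ≡ k ⊓ length region
    largest    : ∀ {p q} → p ∈ ans → q ∈ region → q ∉ ans → q ≺ p
    decreasing : AllPairs (λ p q → q ≺ p) ans

module _ {Pos : Set} (_≟_ : DecidableEquality Pos) where
  open DecMembership _≟_ using (_∈?_)
  open SortedTop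

  module _ {_≺_ : Rel Pos ℓ} (irrefl : Irreflexive _≡_ _≺_) {k : ℕ} {R L : List Pos}
           (top : SortedTop _≺_ k R L) where

    unique-top : Unique L
    unique-top = AllPairs.map (λ q≺p p≡q → irrefl (sym p≡q) q≺p) (decreasing top)

    -- If `z` were missing, `largest` would put all of `L` above it. Then `z ∷ L` would be
    -- duplicate-free and contained in both `M` and `R`, so no longer than `k ⊓ length R`, which is
    -- the length of `L`.
    few-above⇒∈top : ∀ {z} M → z ∈ R → z ∈ M → (∀ {w} → w ∈ R → z ≺ w → w ∈ M) →
                     length M ≤ k → z ∈ L
    few-above⇒∈top {z} M z∈R z∈M above |M|≤k with z ∈? L
    ... | yes z∈L = z∈L
    ... | no  z∉L = ⊥-elim (1+n≰n (begin
      suc (length L)  ≤⟨ ⊓-glb (≤-trans (unique-⊆⇒length≤ unique′ ⊆M) |M|≤k)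
                              (unique-⊆⇒length≤ unique′ ⊆R) ⟩
      k ⊓ length R    ≡⟨ size top ⟨
      length L        ∎))
      where
      open ≤-Reasoning
      unique′ : Unique (z ∷ L)
      unique′ = All.tabulate (λ w∈L z≡w → z∉L (subst (_∈ L) (sym z≡w) w∈L)) ∷ unique-top
      ⊆R : z ∷ L ⊆ R
      ⊆R (here refl) = z∈R
      ⊆R (there w∈L) = All.lookup (inside top) w∈L
      ⊆M : z ∷ L ⊆ M
      ⊆M (here refl)  = z∈M
      ⊆M (there w∈L) = above (All.lookup (inside top) w∈L) (largest top w∈L z∈R z∉L)

  -- For a loser outside `L` this is `largest`; inside `L` the common list order decides. Equal
  -- answers thus become equal outcomes of single comparisons.
  same-top⇒agree : {_≺_ : Rel Pos ℓ} {_≺′_ : Rel Pos ℓ′} {k : ℕ} {R L : List Pos} →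
                   (∀ {x y} → x ≺ y → ¬ y ≺ x) →
                   SortedTop _≺_ k R L → SortedTop _≺′_ k R L →
                   ∀ {z w} → z ∈ L → w ∈ R → w ≺ z → w ≺′ z
  same-top⇒agree {L = L} asym top top′ {z} {w} z∈L w∈R w≺z with w ∈? L
  ... | no  w∉L = largest top′ z∈L w∈R w∉L
  ... | yes w∈L with AllPairs-lookup (AllPairs.zip (decreasing top , decreasing top′)) z∈L w∈L
  ...   | inj₁ refl              = ⊥-elim (asym w≺z w≺z)
  ...   | inj₂ (inj₁ (_ , w≺′z)) = w≺′z
  ...   | inj₂ (inj₂ (z≺w , _))  = ⊥-elim (asym w≺z z≺w)

  -- Converse: `largest` and `decreasing` speak only of comparisons won by members of `L`.
  agree⇒same-top : {_≺_ : Rel Pos ℓ} {_≺′_ : Rel Pos ℓ′} {k : ℕ} {R L : List Pos} →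
                   (∀ {z w} → z ∈ L → w ∈ R → w ≺ z → w ≺′ z) →
                   SortedTop _≺_ k R L → SortedTop _≺′_ k R L
  agree⇒same-top {_≺_ = _≺_} {_≺′_} {R = R} {L} agree top = record
    { inside     = inside top
    ; size       = size top
    ; largest    = λ p∈L q∈R q∉L → agree p∈L q∈R (largest top p∈L q∈R q∉L)
    ; decreasing = go id (All.lookup (inside top)) (decreasing top)
    }
    where
    go : ∀ {xs} → xs ⊆ L → xs ⊆ R → AllPairs (λ p q → q ≺ p) xs → AllPairs (λ p q → q ≺′ p) xs
    go _ _ [] = []
    go xs⊆L xs⊆R (ps ∷ pss) =
      All.tabulate (λ q∈xs → agree (xs⊆L (here refl)) (xs⊆R (there q∈xs)) (All.lookup ps q∈xs))
      ∷ go (xs⊆L ∘ there) (xs⊆R ∘ there) pss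

  sortedTop? : {_≺_ : Rel Pos ℓ} → (∀ x y → Dec (x ≺ y)) → ∀ k R L → Dec (SortedTop _≺_ k R L)
  sortedTop? {_≺_ = _≺_} _≺?_ k R L = map′ to from
    (All.all? (_∈? R) L
     ×-dec (length L ≟ⁿ k ⊓ length R)
     ×-dec All.all? (λ p → All.all? (λ q → ¬? (q ∈? L) →-dec (q ≺? p)) R) L
     ×-dec AllPairs.allPairs? (λ p q → q ≺? p) L)
    where
    to : _ → SortedTop _≺_ k R L
    to (i , s , l , d) = record
      { inside = i ; size = s ; decreasing = d
      ; largest = λ p∈L q∈R → All.lookup (All.lookup l p∈L) q∈R }
    from : SortedTop _≺_ k R L → _
    from t = inside t , size t
           , All.tabulate (λ p∈L → All.tabulate (λ q∈R → largest t p∈L q∈R)) , decreasing t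

  sortedTop-resp : {_≺_ : Rel Pos ℓ} {k : ℕ} {R R′ L : List Pos} → R ⊆ R′ → R′ ⊆ R →
                   length R ≡ length R′ → SortedTop _≺_ k R L → SortedTop _≺_ k R′ L
  sortedTop-resp {k = k} R⊆R′ R′⊆R |R|≡|R′| top = record
    { inside     = All.map R⊆R′ (inside top)
    ; size       = trans (size top) (cong (k ⊓_) |R|≡|R′|)
    ; largest    = λ p∈L q∈R′ → largest top p∈L (R′⊆R q∈R′)
    ; decreasing = decreasing top
    }

  []-sortedTop : {_≺_ : Rel Pos ℓ} {k : ℕ} {R : List Pos} → k ⊓ length R ≡ 0 → SortedTop _≺_ k R []
  []-sortedTop k⊓|R|≡0 = record
    { inside = [] ; size = sym k⊓|R|≡0 ; largest = λ () ; decreasing = [] }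

-- Peeling off the common prefix of all candidates

module Candidates {Pos Cand : Set} (_≟_ : DecidableEquality Pos) (rank : Cand → Pos → ℕ) where
  open SortedTop

  infix 4 _<[_]_
  _<[_]_ : Pos → Cand → Pos → Set
  x <[ c ] y = rank c x < rank c y

  Resolved : ℕ → List Cand → List Pos → Set
  Resolved k 𝒞 R = ∃ λ L → ∀ {c} → c ∈ 𝒞 → SortedTop (λ x y → x <[ c ] y) k R L

  -- Quantifying over ordered pairs of candidates expresses unanimity without naming the outcome.
  Known : List Cand → Pos → Pos → Set
  Known 𝒞 z w = ∀ {c c′} → c ∈ 𝒞 → c′ ∈ 𝒞 → w <[ c ] z → w <[ c′ ] z

  Settled : List Cand → List Pos → Pos → Set
  Settled 𝒞 R z = ∀ {w} → w ∈ R → Known 𝒞 z w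

  Maximal : Cand → List Pos → Pos → Set
  Maximal c xs z = ∀ {w} → w ∈ xs → rank c w ≤ rank c z

  -- The state in which peeling gets stuck: `placed` holds what has been peeled off, and `c₁`
  -- contests the maximum `z` that `c₀` finds in the remainder.
  record Split (k : ℕ) (𝒞 : List Cand) (R : List Pos) : Set where
    field
      {placed rem}    : List Pos
      {z w}           : Pos
      {c₀ c₁}         : Cand
      c₀∈𝒞            : c₀ ∈ 𝒞
      c₁∈𝒞            : c₁ ∈ 𝒞
      rem⊆R           : rem ⊆ R
      covered         : ∀ {x} → x ∈ R → x ∈ placed ⊎ x ∈ rem
      settled         : ∀ {x} → x ∈ placed → Settled 𝒞 R x
      short           : length placed < k
      z∈rem           : z ∈ rem
      w∈rem           : w ∈ rem
      z-max           : Maximal c₀ rem z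
      w-above         : z <[ c₁ ] w

  maximum : ∀ c {x xs} → x ∈ xs → ∃ λ z → z ∈ xs × Maximal c xs z
  maximum c {x} {xs} x∈xs =
    argmax (rank c) x xs , argmax-all (rank c) x∈xs (All.tabulate id) ,
    All.lookup (f[xs]≤f[argmax] x xs)

  module _ (k : ℕ) {𝒞 : List Cand} (inj : ∀ {c} → c ∈ 𝒞 → Injective _≡_ _≡_ (rank c))
           {c₀ : Cand} (c₀∈𝒞 : c₀ ∈ 𝒞) (R : List Pos) where

    maximal⇒< : ∀ {c xs z w} → c ∈ 𝒞 → Maximal c xs z → w ∈ xs → w ≢ z → w <[ c ] z
    maximal⇒< c∈𝒞 z-max w∈xs w≢z = ≤∧≢⇒< (z-max w∈xs) (w≢z ∘ inj c∈𝒞)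

    -- The maximum of `rem` under `c₀` moves to `placed` as long as no candidate disputes it, so
    -- placed positions beat the remaining ones in every candidate. `j` counts the places still to
    -- be filled.
    peel : ∀ j placed rem → length placed + j ≡ k → Unique rem → rem ⊆ R →
           (∀ {x} → x ∈ R → x ∈ placed ⊎ x ∈ rem) →
           (∀ {c x y} → c ∈ 𝒞 → x ∈ placed → y ∈ rem → y <[ c ] x) →
           (∀ {x} → x ∈ placed → Settled 𝒞 R x) →
           Resolved j 𝒞 rem ⊎ Split k 𝒞 R
    peel zero placed rem _ _ _ _ _ _ = inj₁ ([] , λ _ → []-sortedTop _≟_ refl)
    peel (suc j) placed [] _ _ _ _ _ _ = inj₁ ([] , λ _ → []-sortedTop _≟_ refl)
    peel (suc j) placed rem@(x ∷ _) |placed|+1+j≡k unique rem⊆R covered above settled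
      with maximum c₀ {xs = rem} (here refl)
    ... | z , z∈rem , z-max
      with Any.any? (λ c → Any.any? (λ w → rank c z <? rank c w) rem) 𝒞
    ... | yes rival with find rival
    ...   | _ , c₁∈𝒞 , rival′ with find rival′
    ...     | _ , w∈rem , w-above = inj₂ (record
      { c₀∈𝒞 = c₀∈𝒞 ; c₁∈𝒞 = c₁∈𝒞 ; rem⊆R = rem⊆R ; covered = covered ; settled = settled
      ; short = subst (length placed <_) |placed|+1+j≡k (m<m+n (length placed) (s≤s z≤n))
      ; z∈rem = z∈rem ; w∈rem = w∈rem ; z-max = z-max ; w-above = w-above })
    peel (suc j) placed rem@(x ∷ _) |placed|+1+j≡k unique rem⊆R covered above settled
        | z , z∈rem , z-max | no ¬rival
      = Sum.map₁ extend (peel j (z ∷ placed) rem′ (trans (sym (+-suc (length placed) j)) |placed|+1+j≡k)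
          (unique-filter⁺ ≢z? unique) (rem⊆R ∘ rem′⊆rem) covered′ above′ settled′)
      where
      ≢z? : ∀ w → Dec (w ≢ z)
      ≢z? w = ¬? (w ≟ z)
      rem′ : List Pos
      rem′ = filter ≢z? rem
      rem′⊆rem : rem′ ⊆ rem
      rem′⊆rem = proj₁ ∘ ∈-filter⁻ ≢z? {xs = rem}
      z-max′ : ∀ {c} → c ∈ 𝒞 → Maximal c rem z
      z-max′ c∈𝒞 w∈rem = ≮⇒≥ λ z<w → ¬rival (lose c∈𝒞 (lose w∈rem z<w))
      z-above : ∀ {c w} → c ∈ 𝒞 → w ∈ rem′ → w <[ c ] z
      z-above c∈𝒞 w∈rem′ with ∈-filter⁻ ≢z? {xs = rem} w∈rem′
      ... | w∈rem , w≢z = maximal⇒< c∈𝒞 (z-max′ c∈𝒞) w∈rem w≢z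
      split : ∀ {w} → w ∈ rem → w ≡ z ⊎ w ∈ rem′
      split {w} w∈rem with w ≟ z
      ... | yes w≡z = inj₁ w≡z
      ... | no  w≢z = inj₂ (∈-filter⁺ ≢z? w∈rem w≢z)
      covered′ : ∀ {x} → x ∈ R → x ∈ z ∷ placed ⊎ x ∈ rem′
      covered′ x∈R with covered x∈R
      ... | inj₁ x∈placed = inj₁ (there x∈placed)
      ... | inj₂ x∈rem    = Sum.map₁ here (split x∈rem)
      above′ : ∀ {c x y} → c ∈ 𝒞 → x ∈ z ∷ placed → y ∈ rem′ → y <[ c ] x
      above′ c∈𝒞 (here refl)      y∈rem′ = z-above c∈𝒞 y∈rem′
      above′ c∈𝒞 (there x∈placed) y∈rem′ = above c∈𝒞 x∈placed (rem′⊆rem y∈rem′)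
      -- Any other position of `R` is unanimously above `z` if placed earlier and unanimously below
      -- it if it remains.
      settled′ : ∀ {x} → x ∈ z ∷ placed → Settled 𝒞 R x
      settled′ (there x∈placed) = settled x∈placed
      settled′ (here refl) w∈R c∈𝒞 c′∈𝒞 w<z with covered w∈R
      ... | inj₁ w∈placed = ⊥-elim (<-asym w<z (above c∈𝒞 w∈placed z∈rem))
      ... | inj₂ w∈rem with split w∈rem
      ...   | inj₁ refl   = ⊥-elim (<-irrefl refl w<z)
      ...   | inj₂ w∈rem′ = z-above c′∈𝒞 w∈rem′
      |rem| : suc (length rem′) ≡ length rem
      |rem| = ≤-antisym
        (unique-⊆⇒length≤ (All.tabulate (λ w∈rem′ z≡w → proj₂ (∈-filter⁻ ≢z? {xs = rem} w∈rem′) (sym z≡w))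
                           ∷ unique-filter⁺ ≢z? unique)
                          λ { (here refl) → z∈rem ; (there w∈rem′) → rem′⊆rem w∈rem′ })
        (unique-⊆⇒length≤ unique λ w∈rem → [ here , there ]′ (split w∈rem))
      extend : Resolved j 𝒞 rem′ → Resolved (suc j) 𝒞 rem
      extend (L , top) = z ∷ L , λ {c} c∈𝒞 → let t = top c∈𝒞 in record
        { inside     = z∈rem ∷ All.map rem′⊆rem (inside t)
        ; size       = trans (cong suc (size t)) (cong (suc j ⊓_) |rem|)
        ; largest    = λ { (here refl) q∈rem q∉ → [ (λ { refl → ⊥-elim (q∉ (here refl)) }) , z-above c∈𝒞 ]′ (split q∈rem)
                         ; (there p∈L) q∈rem q∉ → [ (λ { refl → ⊥-elim (q∉ (here refl)) })
                                                  , (λ q∈rem′ → largest t p∈L q∈rem′ (q∉ ∘ there)) ]′ (split q∈rem) }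
        ; decreasing = All.map (λ p∈rem′ → z-above c∈𝒞 p∈rem′) (inside t) ∷ decreasing t
        }

    resolve : Unique R → Resolved k 𝒞 R ⊎ Split k 𝒞 R
    resolve unique = peel k [] R refl unique id inj₂ (λ _ ()) (λ ())

-- Intervals and the choice of the pair to compare

Interval : ℕ → Set
Interval n = Fin n × Fin n

module _ {n : ℕ} where

  infix 4 _∈ᴵ_
  _∈ᴵ_ : Fin n → Interval n → Set
  p ∈ᴵ (a , b) = a Fin.≤ p × p Fin.≤ b

  columns : Interval n → List (Fin n)
  columns (a , b) = filter (λ p → (a Fin.≤? p) ×-dec (p Fin.≤? b)) (allFin n)

  ∈-columns⁺ : ∀ J {p} → p ∈ᴵ J → p ∈ columns J
  ∈-columns⁺ (a , b) {p} p∈J = ∈-filter⁺ (λ p → (a Fin.≤? p) ×-dec (p Fin.≤? b)) (∈-allFin p) p∈J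

  ∈-columns⁻ : ∀ J {p} → p ∈ columns J → p ∈ᴵ J
  ∈-columns⁻ (a , b) p∈J = proj₂ (∈-filter⁻ (λ p → (a Fin.≤? p) ×-dec (p Fin.≤? b)) {xs = allFin n} p∈J)

  unique-columns : ∀ J → Unique (columns J)
  unique-columns (a , b) = unique-filter⁺ (λ p → (a Fin.≤? p) ×-dec (p Fin.≤? b)) (unique-allFin n)

-- Abstracts from a fixed pair of rows: `Open` stands for the unresolved intervals, and `Head J p q`
-- says that `p` and `q` are the undecided heads of the two rows over `J`.
module Selection {n : ℕ} {ℓ ℓ′ : Level} (Open : Interval n → Set ℓ) (open? : Decidable Open)
  (Head : Interval n → Fin n → Fin n → Set ℓ′)
  (head : ∀ {J} → Open J → ∃₂ (Head J))
  (head-inside : ∀ {J p q} → Head J p q → p ∈ᴵ J × q ∈ᴵ J)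
  (head-unique : ∀ {I J p q p′ q′} → Head I p q → Head J p′ q′ →
                 p ∈ᴵ J → q ∈ᴵ J → p′ ∈ᴵ I → q′ ∈ᴵ I → p ≡ p′ × q ≡ q′)
  where

  left right : Fin n → Fin n → ℕ
  left  p q = toℕ p ⊓ toℕ q
  right p q = toℕ p ⊔ toℕ q

  lo hi : Interval n → ℕ
  lo = toℕ ∘ proj₁
  hi   = toℕ ∘ proj₂

  -- `I₁` serves the charge of a winner on the right and `I₂` that of a winner on the left, so each
  -- end of the run has to be extremal for one side only.
  record Selected : Set (ℓ ⊔ˡ ℓ′) where
    field
      {p q}      : Fin n
      {I₁ I₂}    : Interval n
      open₁      : Open I₁
      open₂      : Open I₂
      head₁      : Head I₁ p q
      head₂      : Head I₂ p q
      left-most  : ∀ {J} → Open J → right p q ≤ hi J → lo J ≤ right p q → lo I₁ ≤ lo J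
      right-most : ∀ {J} → Open J → lo J ≤ left p q → left p q ≤ hi J → hi J ≤ hi I₂

  private
    intervals : List (Interval n)
    intervals = cartesianProduct (allFin n) (allFin n)

    ∈-intervals : ∀ J → J ∈ intervals
    ∈-intervals (a , b) = ∈-cartesianProduct⁺ (∈-allFin a) (∈-allFin b)

    -- Lexicographic key: earlier start first, then later end. The factor `suc n` exceeds every
    -- value of `n ∸ hi J`.
    μ : Interval n → ℕ
    μ J = lo J * suc n + (n ∸ hi J)

    μ-lo : ∀ {I J} → lo I < lo J → μ I < μ J
    μ-lo {I} {J} lI<lJ = begin-strict
      lo I * suc n + (n ∸ hi I)  ≤⟨ +-monoʳ-≤ (lo I * suc n) (m∸n≤m n (hi I)) ⟩
      lo I * suc n + n            <⟨ +-monoʳ-< (lo I * suc n) (n<1+n n) ⟩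
      lo I * suc n + suc n        ≡⟨ +-comm (lo I * suc n) (suc n) ⟩
      suc (lo I) * suc n          ≤⟨ *-monoˡ-≤ (suc n) lI<lJ ⟩
      lo J * suc n                ≤⟨ m≤m+n (lo J * suc n) (n ∸ hi J) ⟩
      μ J                            ∎
      where open ≤-Reasoning

    μ-hi : ∀ {I J} → lo I ≤ lo J → hi J < hi I → μ I < μ J
    μ-hi {I} {J} lI≤lJ hJ<hI = +-mono-≤-< (*-monoˡ-≤ (suc n) lI≤lJ)
      (∸-monoʳ-< hJ<hI (<⇒≤ (Fin.toℕ<n (proj₂ I))))

    least : ∀ {ℓ″} {P : Interval n → Set ℓ″} → Decidable P → ∀ {J} → P J →
            ∃ λ I → P I × (∀ {J′} → P J′ → μ I ≤ μ J′)
    least P? {J} PJ =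
      argmin μ J candidates ,
      argmin-all μ PJ (All.tabulate (proj₂ ∘ ∈-filter⁻ P? {xs = intervals})) ,
      λ {J′} PJ′ → All.lookup (f[argmin]≤f[xs] J candidates) (∈-filter⁺ P? (∈-intervals J′) PJ′)
      where candidates = filter P? intervals

    -- I₁ and I₂ are the first and the last interval of a run sharing the head
    -- pair (p , q); `fuel` bounds the number of columns to the right of I₂.
    extend : ∀ fuel {p q I₁ I₂} → Open I₁ → Open I₂ → Head I₁ p q → Head I₂ p q →
             n ∸ hi I₂ ≤ fuel →
             (∀ {J} → Open J → right p q ≤ hi J → lo J ≤ right p q → lo I₁ ≤ lo J) →
             (∀ {J} → Open J → hi I₂ < hi J → lo J ≤ left p q → lo I₂ < lo J) →
             Selected
    extend fuel {p} {q} {I₁} {I₂} open₁ open₂ head₁ head₂ bound left-most beyond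
      -- An open interval that contains the left head and ends after `I₂` is exactly what
      -- `right-most` forbids.
      with Any.any? (λ J → open? J ×-dec (lo J ≤? left p q) ×-dec (hi I₂ <? hi J)) intervals
    ... | no none = record
      { open₁ = open₁ ; open₂ = open₂ ; head₁ = head₁ ; head₂ = head₂ ; left-most = left-most
      ; right-most = λ {J} openJ lJ≤l l≤hJ → ≮⇒≥ λ hI₂<hJ →
          none (lose (∈-intervals J) (openJ , lJ≤l , hI₂<hJ)) }
    ... | yes some with least (λ J → open? J ×-dec (lo J ≤? left p q) ×-dec (hi I₂ <? hi J))
                              (proj₂ (proj₂ (find some)))
    ...   | J , (openJ , lJ≤l , hI₂<hJ) , J-least with head openJ
    ...     | p′ , q′ , headJ = continue fuel bound (right p′ q′ ≤? hi I₂)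
      where
      beyondJ : ∀ {J′} → Open J′ → hi J < hi J′ → lo J < lo J′
      beyondJ {J′} openJ′ hJ<hJ′ = ≰⇒> λ lJ′≤lJ →
        <⇒≱ (μ-hi {J′} {J} lJ′≤lJ hJ<hJ′) (J-least (openJ′ , ≤-trans lJ′≤lJ lJ≤l , <-trans hI₂<hJ hJ<hJ′))

      shrinks : ∀ {f} → n ∸ hi I₂ ≤ suc f → n ∸ hi J ≤ f
      shrinks bound = ≤-pred (≤-trans (∸-monoʳ-< hI₂<hJ (<⇒≤ (Fin.toℕ<n (proj₂ J)))) bound)

      same-pair : right p′ q′ ≤ hi I₂ → p ≡ p′ × q ≡ q′
      same-pair r′≤hI₂ = head-unique head₂ headJ
        (inJ (m⊓n≤m (toℕ p) (toℕ q)) (proj₁ (head-inside head₂)))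
        (inJ (m⊓n≤n (toℕ p) (toℕ q)) (proj₂ (head-inside head₂)))
        (inI₂ (m≤m⊔n (toℕ p′) (toℕ q′)) (proj₁ (head-inside headJ)))
        (inI₂ (m≤n⊔m (toℕ p′) (toℕ q′)) (proj₂ (head-inside headJ)))
        where
        inJ : ∀ {x} → left p q ≤ toℕ x → x ∈ᴵ I₂ → x ∈ᴵ J
        inJ l≤x (_ , x≤hI₂) = ≤-trans lJ≤l l≤x , ≤-trans x≤hI₂ (<⇒≤ hI₂<hJ)
        inI₂ : ∀ {x} → toℕ x ≤ right p′ q′ → x ∈ᴵ J → x ∈ᴵ I₂
        inI₂ x≤r′ (lJ≤x , _) = ≤-trans (<⇒≤ (beyond openJ hI₂<hJ lJ≤l)) lJ≤x , ≤-trans x≤r′ r′≤hI₂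

      continue : ∀ fuel → n ∸ hi I₂ ≤ fuel → Dec (right p′ q′ ≤ hi I₂) → Selected
      continue zero bound _ = ⊥-elim (<⇒≱ (m<n⇒0<n∸m (Fin.toℕ<n (proj₂ I₂))) bound)
      -- The heads of `J` lie in `I₂` and those of `I₂` lie in `J`, so the pairs coincide and the
      -- run grows by `J`.
      continue (suc fuel) bound (yes r′≤hI₂) with same-pair r′≤hI₂
      ... | refl , refl = extend fuel open₁ openJ head₁ headJ (shrinks bound) left-most
                            (λ openJ′ hJ<hJ′ _ → beyondJ openJ′ hJ<hJ′)
      -- The right head of `J` lies beyond `I₂`, and a new run starts at `J`: an open interval that
      -- reaches this head and starts earlier would have been chosen instead of `J`.
      continue (suc fuel) bound (no r′≰hI₂) = extend fuel openJ openJ headJ headJ (shrinks bound)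
        (λ {J′} openJ′ r′≤hJ′ _ → ≮⇒≥ λ lJ′<lJ → <⇒≱ (μ-lo {J′} {J} lJ′<lJ)
           (J-least (openJ′ , ≤-trans (<⇒≤ lJ′<lJ) lJ≤l , <-≤-trans (≰⇒> r′≰hI₂) r′≤hJ′)))
        (λ openJ′ hJ<hJ′ _ → beyondJ openJ′ hJ<hJ′)

  -- The run starts with the longest of the leftmost open intervals: no open interval starts
  -- earlier, and one that ends later also starts later.
  select : ∀ {J} → Open J → Selected
  select openJ with least open? openJ
  ... | I , openI , I-least with head openI
  ...   | _ , _ , headI = extend (n ∸ hi I) openI openI headI headI ≤-refl
          (λ {J} openJ _ _ → ≮⇒≥ λ lJ<lI → <⇒≱ (μ-lo {J} {I} lJ<lI) (I-least openJ))
          (λ {J} openJ hI<hJ _ → ≰⇒> λ lJ≤lI → <⇒≱ (μ-hi {J} {I} lJ≤lI hI<hJ) (I-least openJ))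

-- Unresolved pairs of rows and their heads

module Grid {m n : ℕ} {Cand : Set} (rank : Cand → Fin m × Fin n → ℕ) (k : ℕ) where

  Pos : Set
  Pos = Fin m × Fin n

  _≟ᴾ_ : DecidableEquality Pos
  _≟ᴾ_ = ≡-dec Fin._≟_ Fin._≟_

  open Candidates _≟ᴾ_ rank public

  region : List (Fin m) → Interval n → List Pos
  region is J = cartesianProduct is (columns J)

  row : Fin m → Interval n → List Pos
  row i = region (i ∷ [])

  box : Fin m → Fin m → Interval n → List Pos
  box i j = region (i ∷ j ∷ [])

  unique-region : ∀ {is} → Unique is → ∀ J → Unique (region is J)
  unique-region unique-is J = unique-cartesianProduct⁺ unique-is (unique-columns J)

  ∈-region⁺ : ∀ is J {i p} → i ∈ is → p ∈ᴵ J → (i , p) ∈ region is J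
  ∈-region⁺ is J i∈is p∈J = ∈-cartesianProduct⁺ i∈is (∈-columns⁺ J p∈J)

  ∈-region⁻ : ∀ is J {i p} → (i , p) ∈ region is J → i ∈ is × p ∈ᴵ J
  ∈-region⁻ is J ip∈ with ∈-cartesianProduct⁻ is (columns J) ip∈
  ... | i∈is , p∈J = i∈is , ∈-columns⁻ J p∈J

  ⊆-region : ∀ is js J → is ⊆ js → region is J ⊆ region js J
  ⊆-region is js J is⊆js ip∈ with ∈-cartesianProduct⁻ is (columns J) ip∈
  ... | i∈is , p∈J = ∈-cartesianProduct⁺ (is⊆js i∈is) p∈J

  pair-comm : {i j : Fin m} → i ∷ j ∷ [] ⊆ j ∷ i ∷ []
  pair-comm (here refl)         = there (here refl)
  pair-comm (there (here refl)) = here refl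

  resolved-mono : ∀ {𝒞 𝒞′ R} → 𝒞′ ⊆ 𝒞 → Resolved k 𝒞 R → Resolved k 𝒞′ R
  resolved-mono 𝒞′⊆𝒞 (L , top) = L , top ∘ 𝒞′⊆𝒞

  resolved-swap : ∀ {𝒞 i j J} → Resolved k 𝒞 (box i j J) → Resolved k 𝒞 (box j i J)
  resolved-swap {𝒞} {i} {j} {J} (L , top) =
    L , λ c∈𝒞 → sortedTop-resp _≟ᴾ_ (⊆-region (i ∷ j ∷ []) (j ∷ i ∷ []) J pair-comm) (⊆-region (j ∷ i ∷ []) (i ∷ j ∷ []) J pair-comm)
          (trans (length-cartesianProduct (i ∷ j ∷ []) (columns J))
                 (sym (length-cartesianProduct (j ∷ i ∷ []) (columns J)))) (top c∈𝒞)

  record Pool : Set where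
    field
      candidates : List Cand
      injective  : ∀ {c} → c ∈ candidates → Injective _≡_ _≡_ (rank c)
      rows       : ∀ i J → Resolved k candidates (row i J)

  -- `p` and `q` are the best columns left in rows `i` and `j` below the common prefix, and `c₀` and
  -- `c₁` disagree on which wins. The last alternative of `below-p` and `below-q` covers the prefix
  -- itself.
  record Heads (𝒞 : List Cand) (i j : Fin m) (J : Interval n) (p q : Fin n) : Set where
    field
      p∈J        : p ∈ᴵ J
      q∈J        : q ∈ᴵ J
      unresolved : ¬ Resolved k 𝒞 (box i j J)
      {c₀ c₁}    : Cand
      c₀∈𝒞       : c₀ ∈ 𝒞
      c₁∈𝒞       : c₁ ∈ 𝒞
      -- q<p and p<q compare values, not columns.
      q<p        : (j , q) <[ c₀ ] (i , p)
      p<q        : (i , p) <[ c₁ ] (j , q)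
      below-p    : ∀ {s} → s ∈ᴵ J → s ≡ p ⊎ (∀ {c} → c ∈ 𝒞 → (i , s) <[ c ] (i , p))
                     ⊎ (∀ {t} → t ∈ᴵ J → Known 𝒞 (i , s) (j , t))
      below-q    : ∀ {s} → s ∈ᴵ J → s ≡ q ⊎ (∀ {c} → c ∈ 𝒞 → (j , s) <[ c ] (j , q))
                     ⊎ (∀ {t} → t ∈ᴵ J → Known 𝒞 (j , s) (i , t))

  heads-swap : ∀ {𝒞 i j J p q} → Heads 𝒞 i j J p q → Heads 𝒞 j i J q p
  heads-swap h = record
    { p∈J = q∈J ; q∈J = p∈J ; unresolved = unresolved ∘ resolved-swap
    ; c₀∈𝒞 = c₁∈𝒞 ; c₁∈𝒞 = c₀∈𝒞 ; q<p = p<q ; p<q = q<p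
    ; below-p = below-q ; below-q = below-p }
    where open Heads h

  split-swap : ∀ {𝒞} i j J → Split k 𝒞 (box i j J) → Split k 𝒞 (box j i J)
  split-swap i j J s = record
    { c₀∈𝒞 = c₀∈𝒞 ; c₁∈𝒞 = c₁∈𝒞 ; short = short ; z∈rem = z∈rem ; w∈rem = w∈rem ; z-max = z-max
    ; w-above = w-above
    ; rem⊆R   = ⊆-region (i ∷ j ∷ []) (j ∷ i ∷ []) J pair-comm ∘ rem⊆R
    ; covered = covered ∘ ⊆-region (j ∷ i ∷ []) (i ∷ j ∷ []) J pair-comm
    ; settled = λ x∈placed → settled x∈placed ∘ ⊆-region (j ∷ i ∷ []) (i ∷ j ∷ []) J pair-comm
    }
    where open Split s

  module _ (P : Pool) where
    open Pool P renaming (candidates to 𝒞)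

    -- Injective ranks make comparisons total: a candidate with `w` below `z` would force this on
    -- all the others.
    known-flip : ∀ {z w} → z ≢ w → Known 𝒞 z w → Known 𝒞 w z
    known-flip z≢w known c∈𝒞 c′∈𝒞 z<w = ≤∧≢⇒<
      (≮⇒≥ λ w<z → <-asym z<w (known c′∈𝒞 c∈𝒞 w<z)) (z≢w ∘ injective c′∈𝒞)

    module _ {i j : Fin m} (i≢j : i ≢ j) {J : Interval n} (s : Split k 𝒞 (box i j J)) where
      open Split s

      above-maximal⇒placed : ∀ {c x y} → Maximal c rem x → y ∈ box i j J → x <[ c ] y → y ∈ placed
      above-maximal⇒placed x-max y∈box x<y with covered y∈box
      ... | inj₁ y∈placed = y∈placed
      ... | inj₂ y∈rem    = ⊥-elim (<⇒≱ x<y (x-max y∈rem))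

      -- Fewer than k positions of a row beat its best unplaced one, so the
      -- answers on that row already reveal which one this is.
      below-head : ∀ {h p c s} → h ∈ i ∷ j ∷ [] → c ∈ 𝒞 → (h , p) ∈ rem →
                   Maximal c (filter (λ x → proj₁ x Fin.≟ h) rem) (h , p) →
                   s ∈ᴵ J → (h , s) ∈ rem → s ≢ p → ∀ {c′} → c′ ∈ 𝒞 → (h , s) <[ c′ ] (h , p)
      below-head {h} {p} {c} {s} h∈ c∈𝒞 hp∈rem p-max s∈J hs∈rem s≢p c′∈𝒞
        with rows h J
      ... | L , top = same-top⇒agree _≟ᴾ_ <-asym (top c∈𝒞) (top c′∈𝒞) p∈L
                        (∈-region⁺ (h ∷ []) J (here refl) s∈J)
                        (≤∧≢⇒< (p-max (∈-filter⁺ (λ x → proj₁ x Fin.≟ h) hs∈rem refl))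
                               (s≢p ∘ cong proj₂ ∘ injective c∈𝒞))
        where
        above : ∀ {w} → w ∈ row h J → (h , p) <[ c ] w → w ∈ (h , p) ∷ placed
        above {g , t} w∈row p<w with ∈-region⁻ (h ∷ []) J w∈row
        ... | here refl , t∈J with covered (∈-region⁺ (i ∷ j ∷ []) J h∈ t∈J)
        ...   | inj₁ w∈placed = there w∈placed
        ...   | inj₂ w∈rem    = ⊥-elim (<⇒≱ p<w (p-max (∈-filter⁺ (λ x → proj₁ x Fin.≟ h) w∈rem refl)))
        p∈L : (h , p) ∈ L
        p∈L = few-above⇒∈top _≟ᴾ_ (λ { refl → <-irrefl refl }) (top c∈𝒞) ((h , p) ∷ placed)
                (∈-region⁺ (h ∷ []) J (here refl) (proj₂ (∈-region⁻ (i ∷ j ∷ []) J (rem⊆R hp∈rem))))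
                (here refl) above short

      -- All candidates put the other remaining positions of row `i` below `z`, so the rival `w`
      -- lies in row `j`. The best remaining position of that row under `c₁` then contests `z`.
      split⇒heads : proj₁ z ≡ i → ∃₂ (Heads 𝒞 i j J)
      split⇒heads refl = heads (row-of-w (rem⊆R w∈rem))
        where
        p : Fin n
        p = proj₂ z

        p∈J : p ∈ᴵ J
        p∈J = proj₂ (∈-region⁻ (i ∷ j ∷ []) J (rem⊆R z∈rem))

        ofRow : Fin m → List Pos
        ofRow h = filter (λ x → proj₁ x Fin.≟ h) rem

        ofRow⊆rem : ∀ {h} → ofRow h ⊆ rem
        ofRow⊆rem {h} = proj₁ ∘ ∈-filter⁻ (λ x → proj₁ x Fin.≟ h) {xs = rem}

        i-below : ∀ {s} → s ∈ᴵ J → (i , s) ∈ rem → s ≢ p → ∀ {c} → c ∈ 𝒞 → (i , s) <[ c ] (i , p)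
        i-below = below-head (here refl) c₀∈𝒞 z∈rem (z-max ∘ ofRow⊆rem)

        row-of-w : w ∈ box i j J → proj₁ w ≡ j
        row-of-w w∈box with ∈-region⁻ (i ∷ j ∷ []) J w∈box
        ... | there (here w≡j) , _ = w≡j
        ... | here refl , s∈J = ⊥-elim (<-asym w-above
              (i-below s∈J w∈rem (λ { refl → <-irrefl refl w-above }) c₁∈𝒞))

        heads : proj₁ w ≡ j → ∃₂ (Heads 𝒞 i j J)
        heads w≡j with maximum c₁ (∈-filter⁺ (λ x → proj₁ x Fin.≟ j) w∈rem w≡j)
        ... | (h , q) , v∈ , v-max with ∈-filter⁻ (λ x → proj₁ x Fin.≟ j) {xs = rem} v∈
        ...   | v∈rem , refl = p , q , record
          { p∈J = p∈J
          ; q∈J = proj₂ (∈-region⁻ (i ∷ j ∷ []) J (rem⊆R v∈rem))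
          ; unresolved = unresolved
          ; c₀∈𝒞 = c₀∈𝒞
          ; c₁∈𝒞 = c₁∈𝒞
          ; q<p = q<p
          ; p<q = p<q
          ; below-p = λ {s} s∈J → position (here refl) (there (here refl)) s∈J (i-below s∈J)
          ; below-q = λ {s} s∈J → position (there (here refl)) (here refl) s∈J
              (below-head (there (here refl)) c₁∈𝒞 v∈rem v-max s∈J)
          }
          where
          q<p : (j , q) <[ c₀ ] (i , p)
          q<p = ≤∧≢⇒< (z-max v∈rem) (i≢j ∘ sym ∘ cong proj₁ ∘ injective c₀∈𝒞)

          p<q : (i , p) <[ c₁ ] (j , q)
          p<q = <-≤-trans w-above (v-max (∈-filter⁺ (λ x → proj₁ x Fin.≟ j) w∈rem w≡j))

          position : ∀ {g h s x} → g ∈ i ∷ j ∷ [] → h ∈ i ∷ j ∷ [] → s ∈ᴵ J →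
                     ((g , s) ∈ rem → s ≢ x → ∀ {c} → c ∈ 𝒞 → (g , s) <[ c ] (g , x)) →
                     s ≡ x ⊎ (∀ {c} → c ∈ 𝒞 → (g , s) <[ c ] (g , x))
                       ⊎ (∀ {t} → t ∈ᴵ J → Known 𝒞 (g , s) (h , t))
          position {s = s} {x} g∈ h∈ s∈J below with covered (∈-region⁺ (i ∷ j ∷ []) J g∈ s∈J) | s Fin.≟ x
          ... | inj₁ s∈placed | _       = inj₂ (inj₂ λ t∈J → settled s∈placed (∈-region⁺ (i ∷ j ∷ []) J h∈ t∈J))
          ... | inj₂ s∈rem    | yes s≡x = inj₁ s≡x
          ... | inj₂ s∈rem    | no  s≢x = inj₂ (inj₁ (below s∈rem s≢x))

          -- A common list would contain `z`, which has fewer than `k` positions above it in `c₀`.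
          -- It would then fix the comparison with `(j , q)`, on which `c₀` and `c₁` differ.
          unresolved : ¬ Resolved k 𝒞 (box i j J)
          unresolved (L , top) = <-asym p<q
            (same-top⇒agree _≟ᴾ_ <-asym (top c₀∈𝒞) (top c₁∈𝒞)
              (few-above⇒∈top _≟ᴾ_ (λ { refl → <-irrefl refl }) (top c₀∈𝒞) (z ∷ placed) (rem⊆R z∈rem) (here refl)
                (λ y∈box z<y → there (above-maximal⇒placed z-max y∈box z<y)) short)
              (rem⊆R v∈rem) q<p)

    resolved-or-heads : ∀ {i j} → i ≢ j → ∀ J → Resolved k 𝒞 (box i j J) ⊎ ∃₂ (Heads 𝒞 i j J)
    resolved-or-heads {i} {j} i≢j J = by-cases 𝒞 refl
      where
      by-cases : ∀ xs → xs ≡ 𝒞 → Resolved k 𝒞 (box i j J) ⊎ ∃₂ (Heads 𝒞 i j J)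
      -- With no candidate left, any list resolves the box.
      by-cases []      []≡𝒞   = inj₁ (subst (λ xs → Resolved k xs (box i j J)) []≡𝒞 ([] , λ ()))
      by-cases (c ∷ _) c∷xs≡𝒞 with resolve k injective (subst (c ∈_) c∷xs≡𝒞 (here refl)) (box i j J)
                                     (unique-region ((i≢j ∷ []) ∷ [] ∷ []) J)
      ... | inj₁ resolved = inj₁ resolved
      ... | inj₂ s with ∈-region⁻ (i ∷ j ∷ []) J (Split.rem⊆R s (Split.z∈rem s))
      ...   | here z≡i , _         = inj₂ (split⇒heads i≢j s z≡i)
      ...   | there (here z≡j) , _ with split⇒heads (i≢j ∘ sym) (split-swap i j J s) z≡j
      ...     | q , p , h = inj₂ (p , q , heads-swap h)

    unresolved? : ∀ {i j} → i ≢ j → ∀ J → Dec (¬ Resolved k 𝒞 (box i j J))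
    unresolved? i≢j J with resolved-or-heads i≢j J
    ... | inj₁ resolved  = no λ unresolved → unresolved resolved
    ... | inj₂ (_ , _ , h) = yes (Heads.unresolved h)

    heads-of : ∀ {i j} → i ≢ j → ∀ {J} → ¬ Resolved k 𝒞 (box i j J) → ∃₂ (Heads 𝒞 i j J)
    heads-of i≢j {J} unresolved with resolved-or-heads i≢j J
    ... | inj₁ resolved = ⊥-elim (unresolved resolved)
    ... | inj₂ h        = h

    -- `p′` is not in the prefix over `I`: its comparison with `q′` would be known, yet the two
    -- candidates of `h′` disagree on it.
    heads-top : ∀ {i j I J p q p′ q′} → Heads 𝒞 i j I p q → Heads 𝒞 i j J p′ q′ →
                p′ ∈ᴵ I → q′ ∈ᴵ I → p′ ≡ p ⊎ (∀ {c} → c ∈ 𝒞 → (i , p′) <[ c ] (i , p))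
    heads-top h h′ p′∈I q′∈I with Heads.below-p h p′∈I
    ... | inj₁ p′≡p         = inj₁ p′≡p
    ... | inj₂ (inj₁ below) = inj₂ below
    ... | inj₂ (inj₂ known) = ⊥-elim (<-asym (Heads.p<q h′)
            (known q′∈I (Heads.c₀∈𝒞 h′) (Heads.c₁∈𝒞 h′) (Heads.q<p h′)))

    -- Otherwise each of `p` and `p′` would be below the other.
    heads-unique-p : ∀ {i j I J p q p′ q′} → Heads 𝒞 i j I p q → Heads 𝒞 i j J p′ q′ →
                     p ∈ᴵ J → q ∈ᴵ J → p′ ∈ᴵ I → q′ ∈ᴵ I → p ≡ p′
    heads-unique-p h h′ p∈J q∈J p′∈I q′∈I with heads-top h h′ p′∈I q′∈I | heads-top h′ h p∈J q∈J
    ... | inj₁ p′≡p | _         = sym p′≡p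
    ... | inj₂ _    | inj₁ p≡p′ = p≡p′
    ... | inj₂ p′<p | inj₂ p<p′ = ⊥-elim (<-asym (p′<p (Heads.c₀∈𝒞 h)) (p<p′ (Heads.c₀∈𝒞 h)))

-- The comparison game and its charges

data Charge (m n : ℕ) : Set where
  rightward leftward : Fin m → Fin n → Fin m → Charge m n

-- A loser in the winner's own column counts as lying to the right.
charge : ∀ {m n} → Fin m → Fin n → Fin m → Fin n → Charge m n
charge i p j q with p Fin.≤? q
... | yes _ = rightward i p j
... | no  _ = leftward i p j

module Game {m n : ℕ} {Cand : Set} (rank : Cand → Fin m × Fin n → ℕ) (k : ℕ) where
  open Grid rank k

  -- A guarded charge cannot be earned by any comparison chosen for 𝒞 (heads⇒fresh).
  Guard : List Cand → Charge m n → Set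
  Guard 𝒞 (rightward i p j) = ∀ {J q} → ¬ Resolved k 𝒞 (box i j J) → p ∈ᴵ J → q ∈ᴵ J →
                              p Fin.≤ q → Known 𝒞 (i , p) (j , q)
  Guard 𝒞 (leftward i p j)  = ∀ {J q} → ¬ Resolved k 𝒞 (box i j J) → p ∈ᴵ J → q ∈ᴵ J →
                              q Fin.< p → Known 𝒞 (i , p) (j , q)

  -- In a smaller pool no new interval becomes unresolved, and unanimity persists.
  guard-mono : ∀ {𝒞 𝒞′} → 𝒞′ ⊆ 𝒞 → ∀ ch → Guard 𝒞 ch → Guard 𝒞′ ch
  guard-mono 𝒞′⊆𝒞 (rightward i p j) guard open′ p∈J q∈J p≤q c∈ c′∈ =
    guard (open′ ∘ resolved-mono 𝒞′⊆𝒞) p∈J q∈J p≤q (𝒞′⊆𝒞 c∈) (𝒞′⊆𝒞 c′∈)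
  guard-mono 𝒞′⊆𝒞 (leftward i p j) guard open′ p∈J q∈J q<p c∈ c′∈ =
    guard (open′ ∘ resolved-mono 𝒞′⊆𝒞) p∈J q∈J q<p (𝒞′⊆𝒞 c∈) (𝒞′⊆𝒞 c′∈)

  -- The outcome is open when the pair is picked, so both possible charges must be unguarded before,
  -- and whichever is earned must be guarded afterwards.
  record Choice (𝒞 : List Cand) : Set where
    field
      {i j}  : Fin m
      {p q}  : Fin n
      i≢j    : i ≢ j
      fresh₁ : ¬ Guard 𝒞 (charge i p j q)
      fresh₂ : ¬ Guard 𝒞 (charge j q i p)
      guard₁ : ∀ {𝒞′} → 𝒞′ ⊆ 𝒞 → (∀ {c} → c ∈ 𝒞′ → (j , q) <[ c ] (i , p)) → Guard 𝒞′ (charge i p j q)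
      guard₂ : ∀ {𝒞′} → 𝒞′ ⊆ 𝒞 → (∀ {c} → c ∈ 𝒞′ → (i , p) <[ c ] (j , q)) → Guard 𝒞′ (charge j q i p)

  -- A guard would settle the comparison of the heads, on which `c₀` and `c₁` differ.
  heads⇒fresh : ∀ {𝒞 i j J p q} → Heads 𝒞 i j J p q → ¬ Guard 𝒞 (charge i p j q)
  heads⇒fresh {p = p} {q} h guard with p Fin.≤? q
  ... | yes p≤q = <-asym p<q (guard unresolved p∈J q∈J p≤q c₀∈𝒞 c₁∈𝒞 q<p) where open Heads h
  ... | no  p≰q = <-asym p<q (guard unresolved p∈J q∈J (≰⇒> p≰q) c₀∈𝒞 c₁∈𝒞 q<p) where open Heads h

  module _ (P : Pool) where
    open Pool P renaming (candidates to 𝒞)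

    -- Outside the prefix, every position of row `j` over `J` is at or below `(j , q)` and loses to
    -- `(i , p)` by transitivity. Comparisons with the prefix were known before.
    winner-known : ∀ {i j J p q s 𝒞′} → i ≢ j → Heads 𝒞 i j J p q → 𝒞′ ⊆ 𝒞 →
                   (∀ {c} → c ∈ 𝒞′ → (j , q) <[ c ] (i , p)) → s ∈ᴵ J → Known 𝒞′ (i , p) (j , s)
    winner-known i≢j h 𝒞′⊆𝒞 wins s∈J {_} {c′} c∈𝒞′ c′∈𝒞′ s<p with Heads.below-q h s∈J
    ... | inj₁ refl          = wins c′∈𝒞′
    ... | inj₂ (inj₁ below)  = <-trans (below (𝒞′⊆𝒞 c′∈𝒞′)) (wins c′∈𝒞′)
    ... | inj₂ (inj₂ known)  = known-flip P (i≢j ∘ sym ∘ cong proj₁) (known (Heads.p∈J h))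
                                 (𝒞′⊆𝒞 c∈𝒞′) (𝒞′⊆𝒞 c′∈𝒞′) s<p

    -- In an unresolved interval containing `p`, a rightward column lies in `I₂` by `right-most` and
    -- a leftward one in `I₁` by `left-most`. There `winner-known` applies.
    heads⇒guard : ∀ {i j I₁ I₂ p q 𝒞′} → i ≢ j → Heads 𝒞 i j I₁ p q → Heads 𝒞 i j I₂ p q →
      (∀ {J} → ¬ Resolved k 𝒞 (box i j J) → p ∈ᴵ J → q Fin.< p → proj₁ I₁ Fin.≤ proj₁ J) →
      (∀ {J} → ¬ Resolved k 𝒞 (box i j J) → p ∈ᴵ J → p Fin.≤ q → proj₂ J Fin.≤ proj₂ I₂) →
      𝒞′ ⊆ 𝒞 → (∀ {c} → c ∈ 𝒞′ → (j , q) <[ c ] (i , p)) → Guard 𝒞′ (charge i p j q)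
    heads⇒guard {p = p} {q} i≢j h₁ h₂ left-most right-most 𝒞′⊆𝒞 wins with p Fin.≤? q
    ... | yes p≤q = λ open′ p∈J s∈J p≤s → winner-known i≢j h₂ 𝒞′⊆𝒞 wins
            ( ≤-trans (proj₁ (Heads.p∈J h₂)) p≤s
            , ≤-trans (proj₂ s∈J) (right-most (open′ ∘ resolved-mono 𝒞′⊆𝒞) p∈J p≤q))
    ... | no p≰q = λ open′ p∈J s∈J s<p → winner-known i≢j h₁ 𝒞′⊆𝒞 wins
            ( ≤-trans (left-most (open′ ∘ resolved-mono 𝒞′⊆𝒞) p∈J (≰⇒> p≰q)) (proj₁ s∈J)
            , ≤-trans (<⇒≤ s<p) (proj₂ (Heads.p∈J h₁)))

    choose-in : ∀ {i j} → i ≢ j → ∀ {J} → ¬ Resolved k 𝒞 (box i j J) → Choice 𝒞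
    choose-in {i} {j} i≢j openJ = record
      { i≢j    = i≢j
      ; fresh₁ = heads⇒fresh head₁
      ; fresh₂ = heads⇒fresh (heads-swap head₁)
      ; guard₁ = heads⇒guard i≢j head₁ head₂
          -- If column `q` precedes column `p`, then `right p q` is `p`; otherwise `left p q` is.
          (λ open′ (lJ≤p , p≤hJ) q<p → left-most open′
             (subst (_≤ _) (sym (m≥n⇒m⊔n≡m (<⇒≤ q<p))) p≤hJ) (subst (_ ≤_) (sym (m≥n⇒m⊔n≡m (<⇒≤ q<p))) lJ≤p))
          (λ open′ (lJ≤p , p≤hJ) p≤q → right-most open′
             (subst (_ ≤_) (sym (m≤n⇒m⊓n≡m p≤q)) lJ≤p) (subst (_≤ _) (sym (m≤n⇒m⊓n≡m p≤q)) p≤hJ))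
      ; guard₂ = heads⇒guard (i≢j ∘ sym) (heads-swap head₁) (heads-swap head₂)
          (λ open′ (lJ≤q , q≤hJ) p<q → left-most (open′ ∘ resolved-swap)
             (subst (_≤ _) (sym (m≤n⇒m⊔n≡n (<⇒≤ p<q))) q≤hJ) (subst (_ ≤_) (sym (m≤n⇒m⊔n≡n (<⇒≤ p<q))) lJ≤q))
          (λ open′ (lJ≤q , q≤hJ) q≤p → right-most (open′ ∘ resolved-swap)
             (subst (_ ≤_) (sym (m≥n⇒m⊓n≡n q≤p)) lJ≤q) (subst (_≤ _) (sym (m≥n⇒m⊓n≡n q≤p)) q≤hJ))
      }
      where
      module S = Selection (λ J → ¬ Resolved k 𝒞 (box i j J)) (unresolved? P i≢j) (Heads 𝒞 i j)
                   (heads-of P i≢j) (λ h → Heads.p∈J h , Heads.q∈J h)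
                   (λ h h′ p∈J q∈J p′∈I q′∈I →
                     heads-unique-p P h h′ p∈J q∈J p′∈I q′∈I ,
                     heads-unique-p P (heads-swap h) (heads-swap h′) q∈J p∈J q′∈I p′∈I)
      open S.Selected (S.select openJ)

    AllResolved : Set
    AllResolved = ∀ i j → i ≢ j → ∀ J → Resolved k 𝒞 (box i j J)

    -- The search depends on the pool alone, so encoder and decoder arrive at the same pair.
    choose : AllResolved ⊎ Choice 𝒞
    choose with Any.any? (λ (i , j , J) → open? i j J) boxes
      where
      boxes : List (Fin m × Fin m × Interval n)
      boxes = cartesianProduct (allFin m) (cartesianProduct (allFin m) (cartesianProduct (allFin n) (allFin n)))
      open? : ∀ i j J → Dec (∃ λ (i≢j : i ≢ j) → ¬ Resolved k 𝒞 (box i j J))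
      open? i j J with i Fin.≟ j
      ... | yes i≡j = no λ (i≢j , _) → i≢j i≡j
      ... | no  i≢j = map′ (i≢j ,_) proj₂ (unresolved? P i≢j J)
    ... | yes some with find some
    ...   | _ , _ , i≢j , openJ = inj₂ (choose-in i≢j openJ)
    choose | no none = inj₁ λ i j i≢j J →
      [ id , (λ (_ , _ , h) → ⊥-elim (none (lose
        (∈-cartesianProduct⁺ (∈-allFin i) (∈-cartesianProduct⁺ (∈-allFin j)
          (∈-cartesianProduct⁺ (∈-allFin (proj₁ J)) (∈-allFin (proj₂ J)))))
        (i≢j , Heads.unresolved h)))) ]′ (resolved-or-heads P i≢j J)

    verdict : AllResolved ⊎ Choice 𝒞 → Cand → Bool
    -- Filler once everything is resolved: every candidate passes it, and the number of bits stays
    -- fixed.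
    verdict (inj₁ _)  c = false
    verdict (inj₂ ch) c = does (rank c (j , q) <? rank c (i , p)) where open Choice ch

    answer : Cand → Bool
    answer = verdict choose

  refine : Pool → Bool → Pool
  refine P b = record
    { candidates = filter ok? 𝒞
    ; injective  = injective ∘ 𝒞′⊆𝒞
    ; rows       = λ i J → resolved-mono 𝒞′⊆𝒞 (rows i J)
    }
    where
    open Pool P renaming (candidates to 𝒞)
    ok? : ∀ c → Dec (answer P c ≡ b)
    ok? c = answer P c ≟ᵇ b
    𝒞′⊆𝒞 : filter ok? 𝒞 ⊆ 𝒞
    𝒞′⊆𝒞 = proj₁ ∘ ∈-filter⁻ ok? {xs = 𝒞}

  survive : Pool → List Bool → Pool
  survive P []       = P
  survive P (b ∷ bs) = survive (refine P b) bs

  emit : ℕ → Pool → Cand → List Bool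
  emit zero    P c = []
  emit (suc f) P c = answer P c ∷ emit f (refine P (answer P c)) c

  length-emit : ∀ f P c → length (emit f P c) ≡ f
  length-emit zero    P c = refl
  length-emit (suc f) P c = cong suc (length-emit f _ c)

  emit-survives : ∀ f P {c} → c ∈ Pool.candidates P → c ∈ Pool.candidates (survive P (emit f P c))
  emit-survives zero    P c∈𝒞 = c∈𝒞
  emit-survives (suc f) P {c} c∈𝒞 = emit-survives f (refine P (answer P c))
    (∈-filter⁺ (λ c′ → answer P c′ ≟ᵇ answer P c) c∈𝒞 refl)

  refine-⊆ : ∀ P b → Pool.candidates (refine P b) ⊆ Pool.candidates P
  refine-⊆ P b = proj₁ ∘ ∈-filter⁻ (λ c → answer P c ≟ᵇ b) {xs = Pool.candidates P}

  survive-⊆ : ∀ bs P → Pool.candidates (survive P bs) ⊆ Pool.candidates P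
  survive-⊆ []       P = id
  survive-⊆ (b ∷ bs) P = refine-⊆ P b ∘ survive-⊆ bs (refine P b)

  -- `(i , p)` is the winner under the bit `b`, so the two bits take the chosen pair in opposite
  -- orders.
  record Fresh (P : Pool) (b : Bool) : Set where
    field
      {i j}   : Fin m
      {p q}   : Fin n
      i≢j     : i ≢ j
      unused  : ¬ Guard (Pool.candidates P) (charge i p j q)
      guarded : Guard (Pool.candidates (refine P b)) (charge i p j q)

  resolved-or-fresh : ∀ P → AllResolved P ⊎ (∀ b → Fresh P b)
  resolved-or-fresh P = by-cases (choose P) refl
    where
    open Pool P renaming (candidates to 𝒞)

    by-cases : ∀ s → choose P ≡ s → AllResolved P ⊎ (∀ b → Fresh P b)
    by-cases (inj₁ resolved) _  = inj₁ resolved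
    by-cases (inj₂ ch)       eq = inj₂ λ where
        true → record { i≢j = i≢j ; unused = fresh₁ ; guarded = guard₁ (refine-⊆ P true) λ {c} c∈ →
          does-true (rank c (j , q) <? rank c (i , p)) (verdict≡ c∈) }
        false → record { i≢j = i≢j ∘ sym ; unused = fresh₂ ; guarded = guard₂ (refine-⊆ P false) λ {c} c∈ →
          ≤∧≢⇒< (≮⇒≥ (does-false (rank c (j , q) <? rank c (i , p)) (verdict≡ c∈)))
                (i≢j ∘ cong proj₁ ∘ injective (refine-⊆ P false c∈)) }
      where
      open Choice ch
      verdict≡ : ∀ {b c} → c ∈ Pool.candidates (refine P b) → verdict P (inj₂ ch) c ≡ b
      verdict≡ {b} {c} c∈ = subst (λ s → verdict P s c ≡ b) eq
        (proj₂ (∈-filter⁻ (λ c → answer P c ≟ᵇ b) {xs = 𝒞} c∈))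
      does-true : ∀ {X : Set} (d : Dec X) → does d ≡ true → X
      does-true (yes x) _ = x
      does-false : ∀ {X : Set} (d : Dec X) → does d ≡ false → ¬ X
      does-false (no ¬x) _ = ¬x

  module _ (charges : List (Charge m n))
           (complete : ∀ {i j} → i ≢ j → ∀ p q → charge i p j q ∈ charges) where

    -- `U` collects the charges earned so far. All are guarded in the current pool, so the next one
    -- is new. With no bits left, `U` is as long as `charges`, and a further charge would exceed the
    -- supply.
    survivors-resolved : ∀ bs P (U : List (Charge m n)) → Unique U → U ⊆ charges →
      (∀ {ch} → ch ∈ U → Guard (Pool.candidates P) ch) →
      length U + length bs ≡ length charges → AllResolved (survive P bs)
    survivors-resolved bs P U unique U⊆ guards |U|+|bs|≡ with resolved-or-fresh P
    survivors-resolved bs P U unique U⊆ guards |U|+|bs|≡ | inj₁ resolved =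
      λ i j i≢j J → resolved-mono (survive-⊆ bs P) (resolved i j i≢j J)
    survivors-resolved [] P U unique U⊆ guards |U|+0≡ | inj₂ next
      = ⊥-elim (1+n≰n (begin
      suc (length U)      ≤⟨ unique-⊆⇒length≤
                               (All.tabulate (λ { ch∈U refl → unused (guards ch∈U) }) ∷ unique)
                               (λ { (here refl) → complete i≢j p q ; (there ch∈U) → U⊆ ch∈U }) ⟩
      length charges      ≡⟨ |U|+0≡ ⟨
      length U + 0        ≡⟨ +-identityʳ (length U) ⟩
      length U            ∎))
      where
      open ≤-Reasoning
      open Fresh (next true)
    survivors-resolved (b ∷ bs) P U unique U⊆ guards |U|+|bs|≡ | inj₂ next
      = survivors-resolved bs (refine P b) (charge i p j q ∷ U)
        (All.tabulate (λ { ch∈U refl → unused (guards ch∈U) }) ∷ unique)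
        (λ { (here refl) → complete i≢j p q ; (there ch∈U) → U⊆ ch∈U })
        (λ { (here refl) → guarded ; {ch} (there ch∈U) → guard-mono (refine-⊆ P b) ch (guards ch∈U) })
        (trans (sym (+-suc (length U) (length bs))) |U|+|bs|≡)
      where open Fresh (next b)

-- Bit strings and rank matrices

take-length-++ : ∀ {ℓ} {A : Set ℓ} {k} (xs : List A) {ys} → length xs ≡ k → take k (xs ++ ys) ≡ xs
take-length-++ []       refl = refl
take-length-++ (x ∷ xs) refl = cong (x ∷_) (take-length-++ xs refl)

drop-length-++ : ∀ {ℓ} {A : Set ℓ} {k} (xs : List A) {ys} → length xs ≡ k → drop k (xs ++ ys) ≡ ys
drop-length-++ []       refl = refl
drop-length-++ (x ∷ xs) refl = drop-length-++ xs refl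

module FixedWidth (s : ℕ) where

  -- The first `true` marks where the string begins: one extra bit gives all codes of length at most
  -- `s` a common width.
  pad : List Bool → List Bool
  pad xs = replicate (s ∸ length xs) false ++ true ∷ xs

  unpad : List Bool → List Bool
  unpad []           = []
  unpad (false ∷ xs) = unpad xs
  unpad (true  ∷ xs) = xs

  length-pad : ∀ xs → length xs ≤ s → length (pad xs) ≡ suc s
  length-pad xs |xs|≤s = begin
    length (pad xs)                                             ≡⟨ length-++ (replicate (s ∸ length xs) false) ⟩
    length (replicate (s ∸ length xs) false) + suc (length xs)  ≡⟨ cong (_+ suc (length xs)) (length-replicate (s ∸ length xs)) ⟩
    s ∸ length xs + suc (length xs)                             ≡⟨ +-suc (s ∸ length xs) (length xs) ⟩
    suc (s ∸ length xs + length xs)                             ≡⟨ cong suc (m∸n+n≡m |xs|≤s) ⟩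
    suc s                                                       ∎
    where open ≡-Reasoning

  unpad-pad : ∀ xs → unpad (pad xs) ≡ xs
  unpad-pad xs = go (s ∸ length xs)
    where
    go : ∀ d → unpad (replicate d false ++ true ∷ xs) ≡ xs
    go zero    = refl
    go (suc d) = go d

  pack : ∀ {r} → Vec (List Bool) r → List Bool → List Bool
  pack Vec.[]         rest = rest
  pack (xs Vec.∷ xss) rest = pad xs ++ pack xss rest

  unpack : ∀ r → List Bool → Vec (List Bool) r × List Bool
  unpack zero    bs = Vec.[] , bs
  unpack (suc r) bs = map₁ (unpad (take (suc s) bs) Vec.∷_) (unpack r (drop (suc s) bs))

  Short : List Bool → Set
  Short xs = length xs ≤ s

  unpack-pack : ∀ {r} {xss : Vec (List Bool) r} → VecAll Short xss → ∀ rest → unpack r (pack xss rest) ≡ (xss , rest)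
  unpack-pack [] rest = refl
  unpack-pack {xss = xs Vec.∷ xss} (short ∷ shorts) rest
    rewrite take-length-++ (pad xs) {pack xss rest} (length-pad xs short)
          | drop-length-++ (pad xs) {pack xss rest} (length-pad xs short)
          | unpad-pad xs
          | unpack-pack shorts rest = refl

  length-pack : ∀ {r} {xss : Vec (List Bool) r} → VecAll Short xss → ∀ rest →
                length (pack xss rest) ≡ r * suc s + length rest
  length-pack [] rest = refl
  length-pack {suc r} {xs Vec.∷ xss} (short ∷ shorts) rest = begin
    length (pad xs ++ pack xss rest)          ≡⟨ length-++ (pad xs) ⟩
    length (pad xs) + length (pack xss rest)  ≡⟨ cong₂ _+_ (length-pad xs short) (length-pack shorts rest) ⟩
    suc s + (r * suc s + length rest)         ≡⟨ +-assoc (suc s) (r * suc s) (length rest) ⟨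
    suc s + r * suc s + length rest           ∎
    where open ≡-Reasoning

vectors : ∀ {ℓ} {A : Set ℓ} → List A → ∀ r → List (Vec A r)
vectors xs zero    = Vec.[] ∷ []
vectors xs (suc r) = cartesianProductWith Vec._∷_ xs (vectors xs r)

∈-vectors : ∀ {ℓ} {A : Set ℓ} {xs : List A} {r} {v : Vec A r} → VecAll (_∈ xs) v → v ∈ vectors xs r
∈-vectors []           = here refl
∈-vectors (x∈xs ∷ all) = ∈-cartesianProductWith⁺ Vec._∷_ x∈xs (∈-vectors all)

module Ranking {Pos : Set} {ℓ} {_≺_ : Rel Pos ℓ} (_≺?_ : ∀ x y → Dec (x ≺ y))
  (irrefl : Irreflexive _≡_ _≺_) (≺-trans : ∀ {x y z} → x ≺ y → y ≺ z → x ≺ z)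
  (≺-total : ∀ {x y} → x ≢ y → x ≺ y ⊎ y ≺ x) (_≟_ : DecidableEquality Pos)
  {all : List Pos} (unique : Unique all) (complete : ∀ x → x ∈ all) where

  below : Pos → List Pos
  below x = filter (_≺? x) all

  -- Counting smaller positions replaces the values by bounded naturals, so that finitely many
  -- matrices suffice as candidates.
  index : Pos → ℕ
  index = length ∘ below

  index≤ : ∀ x → index x ≤ length all
  index≤ x = unique-⊆⇒length≤ (unique-filter⁺ (_≺? x) unique) (λ {y} _ → complete y)

  index-mono : ∀ {x y} → x ≺ y → index x < index y
  index-mono {x} {y} x≺y = unique-⊆⇒length≤
    (All.tabulate (λ w∈ x≡w → irrefl (sym x≡w) (proj₂ (∈-filter⁻ (_≺? x) {xs = all} w∈)))
      ∷ unique-filter⁺ (_≺? x) unique)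
    λ { (here refl) → ∈-filter⁺ (_≺? y) (complete x) x≺y
      ; {w} (there w∈) → ∈-filter⁺ (_≺? y) (complete w)
          (≺-trans (proj₂ (∈-filter⁻ (_≺? x) {xs = all} w∈)) x≺y) }

  index-reflects : ∀ {x y} → index x < index y → x ≺ y
  index-reflects {x} {y} lt with x ≟ y
  ... | yes refl = ⊥-elim (<-irrefl refl lt)
  ... | no  x≢y  = [ id , (λ y≺x → ⊥-elim (<-asym lt (index-mono y≺x))) ]′ (≺-total x≢y)

  index-injective : Injective _≡_ _≡_ index
  index-injective {x} {y} eq with x ≟ y
  ... | yes x≡y = x≡y
  ... | no  x≢y = ⊥-elim ([ (λ x≺y → <-irrefl eq (index-mono x≺y))
                          , (λ y≺x → <-irrefl (sym eq) (index-mono y≺x)) ]′ (≺-total x≢y))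

-- Counting the possible charges

module Charges (m′ n′ : ℕ) where

  private
    m = suc m′
    n = suc n′

  triples : ∀ l → List (Fin m × Fin l × Fin m′)
  triples l = cartesianProduct (allFin m) (cartesianProduct (allFin l) (allFin m′))

  length-triples : ∀ l → length (triples l) ≡ m * (l * m′)
  length-triples l = begin
    length (triples l)
      ≡⟨ length-cartesianProduct (allFin m) (cartesianProduct (allFin l) (allFin m′)) ⟩
    length (allFin m) * length (cartesianProduct (allFin l) (allFin m′))
      ≡⟨ cong₂ _*_ (length-allFin m) (length-cartesianProduct (allFin l) (allFin m′)) ⟩
    m * (length (allFin l) * length (allFin m′))
      ≡⟨ cong (m *_) (cong₂ _*_ (length-allFin l) (length-allFin m′)) ⟩
    m * (l * m′) ∎
    where
    open ≡-Reasoning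
    length-allFin : ∀ r → length (allFin r) ≡ r
    length-allFin r = length-tabulate {n = r} id

  ∈-triples : ∀ {l} i (p : Fin l) r → (i , p , r) ∈ triples l
  ∈-triples i p r = ∈-cartesianProduct⁺ (∈-allFin i) (∈-cartesianProduct⁺ (∈-allFin p) (∈-allFin r))

  rightwards : Fin m × Fin n × Fin m′ → Charge m n
  rightwards (i , p , r) = rightward i p (Fin.punchIn i r)

  -- A leftward charge is never earned in the first column; this saves the m′
  -- bits that make the row encodings self-delimiting.
  leftwards : Fin m × Fin n′ × Fin m′ → Charge m n
  leftwards (i , p , r) = leftward i (Fin.suc p) (Fin.punchIn i r)

  charges : List (Charge m n)
  charges = map rightwards (triples n) ++ map leftwards (triples n′)

  length-charges : length charges ≡ m * (n * m′) + m * (n′ * m′)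
  length-charges = begin
    length charges
      ≡⟨ length-++ (map rightwards (triples n)) ⟩
    length (map rightwards (triples n)) + length (map leftwards (triples n′))
      ≡⟨ cong₂ _+_ (trans (length-map rightwards (triples n)) (length-triples n))
                   (trans (length-map leftwards (triples n′)) (length-triples n′)) ⟩
    m * (n * m′) + m * (n′ * m′) ∎
    where open ≡-Reasoning

  ∈-charges : ∀ {i j} → i ≢ j → ∀ p q → charge i p j q ∈ charges
  ∈-charges {i} i≢j p q with p Fin.≤? q
  ... | yes _ = ∈-++⁺ˡ (subst (λ h → rightward i p h ∈ map rightwards (triples n)) (Fin.punchIn-punchOut i≢j)
                  (∈-map⁺ rightwards (∈-triples i p (Fin.punchOut i≢j))))
  ∈-charges i≢j Fin.zero q | no p≰q = ⊥-elim (p≰q z≤n)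
  ∈-charges {i} i≢j (Fin.suc p) q | no _ = ∈-++⁺ʳ (map rightwards (triples n))
    (subst (λ h → leftward i (Fin.suc p) h ∈ map leftwards (triples n′)) (Fin.punchIn-punchOut i≢j)
      (∈-map⁺ leftwards (∈-triples i p (Fin.punchOut i≢j))))

-- The encoding

module Answering {m n : ℕ} {Cand : Set} (rank : Cand → Fin m × Fin n → ℕ) (k : ℕ) where
  open Grid rank k
  open Game rank k using (AllResolved)
  open DecMembership _≟ᴾ_ using (_∈?_)
  open SortedTop

  Top : Cand → List Pos → List Pos → Set
  Top c = SortedTop (λ x y → x <[ c ] y) k

  -- A pool of one candidate cannot split, since `c₀` and `c₁` would coincide and `w` would exceed
  -- the maximum.
  top-exists : ∀ {c} → Injective _≡_ _≡_ (rank c) → {R : List Pos} → Unique R → ∃ (Top c R)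
  top-exists {c} inj {R} unique
    with resolve k {𝒞 = c ∷ []} (λ { (here refl) → inj }) (here refl) R unique
  ... | inj₁ (L , top) = L , top (here refl)
  ... | inj₂ s with Split.c₀∈𝒞 s | Split.c₁∈𝒞 s
  ...   | here refl | here refl = ⊥-elim (<⇒≱ (Split.w-above s) (Split.z-max s (Split.w∈rem s)))

  -- Any surviving candidate can stand in for the array. The empty list is a default for an empty
  -- pool, which no encoded array yields.
  report : (𝒞 : List Cand) → (∀ {c} → c ∈ 𝒞 → Injective _≡_ _≡_ (rank c)) →
           {R : List Pos} → Unique R → List Pos
  report []      _   _      = []
  report (_ ∷ _) inj unique = proj₁ (top-exists (inj (here refl)) unique)

  report-top : ∀ {𝒞} (inj : ∀ {c} → c ∈ 𝒞 → Injective _≡_ _≡_ (rank c)) {R : List Pos} (unique : Unique R) →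
               ∀ {c′} → c′ ∈ 𝒞 → ∃ λ c → c ∈ 𝒞 × Top c R (report 𝒞 inj unique)
  report-top {c ∷ _} inj unique _ = c , here refl , proj₂ (top-exists (inj (here refl)) unique)

  module _ (P : Pool) (resolved : AllResolved P) where
    open Pool P renaming (candidates to 𝒞)

    -- A comparison involves at most two rows. Within these, all positions above a member `z` of `L`
    -- are still in `L`, so `z` is in the resolved list there, which fixes the comparison for all
    -- candidates.
    same-top : ∀ {c c′ L} is J → c ∈ 𝒞 → c′ ∈ 𝒞 → Top c (region is J) L → Top c′ (region is J) L
    same-top {c} {c′} {L} is J c∈𝒞 c′∈𝒞 top = agree⇒same-top _≟ᴾ_ agree top
      where
      agree-on : ∀ js → Resolved k 𝒞 (region js J) → js ⊆ is → ∀ {z w} → z ∈ L →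
                 z ∈ region js J → w ∈ region js J → w <[ c ] z → w <[ c′ ] z
      agree-on js (L′ , top′) js⊆is {z} z∈L z∈R w∈R =
        same-top⇒agree _≟ᴾ_ <-asym (top′ c∈𝒞) (top′ c′∈𝒞)
          (few-above⇒∈top _≟ᴾ_ (λ { refl → <-irrefl refl }) (top′ c∈𝒞) L z∈R z∈L above
            (subst (_≤ k) (sym (size top)) (m⊓n≤m k _)))
          w∈R
        where
        above : ∀ {w} → w ∈ region js J → z <[ c ] w → w ∈ L
        above {w} w∈R z<w with w ∈? L
        ... | yes w∈L = w∈L
        ... | no  w∉L = ⊥-elim (<-asym z<w (largest top z∈L (⊆-region js is J js⊆is w∈R) w∉L))

      agree : ∀ {z w} → z ∈ L → w ∈ region is J → w <[ c ] z → w <[ c′ ] z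
      agree {g , p} {h , q} z∈L w∈R with ∈-region⁻ is J (All.lookup (inside top) z∈L) | ∈-region⁻ is J w∈R | g Fin.≟ h
      ... | g∈ , p∈J | h∈ , q∈J | yes refl = agree-on (g ∷ []) (rows g J) (λ { (here refl) → g∈ }) z∈L
              (∈-region⁺ (g ∷ []) J (here refl) p∈J) (∈-region⁺ (g ∷ []) J (here refl) q∈J)
      ... | g∈ , p∈J | h∈ , q∈J | no g≢h = agree-on (g ∷ h ∷ []) (resolved g h g≢h J)
              (λ { (here refl) → g∈ ; (there (here refl)) → h∈ }) z∈L
              (∈-region⁺ (g ∷ h ∷ []) J (here refl) p∈J) (∈-region⁺ (g ∷ h ∷ []) J (there (here refl)) q∈J)

    report-correct : ∀ {c} is J → c ∈ 𝒞 → (unique : Unique (region is J)) →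
                     Top c (region is J) (report 𝒞 injective unique)
    report-correct is J c∈𝒞 unique with report-top injective unique c∈𝒞
    ... | _ , c′∈𝒞 , top = same-top is J c′∈𝒞 c∈𝒞 top

no-members⇒[] : ∀ {ℓ} {A : Set ℓ} {xs : List A} → (∀ {x} → x ∉ xs) → xs ≡ []
no-members⇒[] {xs = []}    _     = refl
no-members⇒[] {xs = _ ∷ _} empty = ⊥-elim (empty (here refl))

module Construction {c ℓ₁ ℓ₂} (O : TotalOrder c ℓ₁ ℓ₂) {m′ n′ k s : ℕ}
  (E : TopK.SortedEncoding₁ O (suc n′) k s) where

  open TopK O
  open Array
  open Encoding E
  open TotalOrder O using (total)
  open TotalOrderProperties O using () renaming (_<_ to _<ᴼ_; <-irrefl to <ᴼ-irrefl; <-asym to <ᴼ-asym; <-trans to <ᴼ-trans)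
  open TotalOrder.Eq O using () renaming (refl to ≈-refl; reflexive to ≈-reflexive)

  m n : ℕ
  m = suc m′
  n = suc n′

  Matrix : Set
  Matrix = Vec (Vec ℕ n) m

  rank : Matrix → Fin m × Fin n → ℕ
  rank c (i , p) = Vec.lookup (Vec.lookup c i) p

  open Grid rank k
  open Game rank k
  open Answering rank k
  open FixedWidth s
  open Charges m′ n′ using (charges; ∈-charges; length-charges)

  grid : List Pos
  grid = cartesianProduct (allFin m) (allFin n)

  ∈-grid : ∀ z → z ∈ grid
  ∈-grid (i , p) = ∈-cartesianProduct⁺ (∈-allFin i) (∈-allFin p)

  rowIntervals : List (Fin m × Interval n)
  rowIntervals = cartesianProduct (allFin m) (cartesianProduct (allFin n) (allFin n))

  ∈-rowIntervals : ∀ i J → (i , J) ∈ rowIntervals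
  ∈-rowIntervals i (a , b) = ∈-cartesianProduct⁺ (∈-allFin i) (∈-cartesianProduct⁺ (∈-allFin a) (∈-allFin b))

  table : Vec (List Bool) m → Fin m → Interval n → List (Fin n)
  table codes i (a , b) with a Fin.≤? b
  ... | yes a≤b = decode (Vec.lookup codes i) (a , b , a≤b)
  ... | no  _   = []

  -- Injectivity and agreement with the row answers, stated over finite lists so that a decoder can
  -- test them from the row codes.
  Consistent : Vec (List Bool) m → Matrix → Set
  Consistent codes c =
    All (λ z → All (λ w → rank c z ≡ rank c w → z ≡ w) grid) grid ×
    All (λ (i , J) → Top c (row i J) (map (i ,_) (table codes i J))) rowIntervals

  consistent? : ∀ codes c → Dec (Consistent codes c)
  consistent? codes c =
    All.all? (λ z → All.all? (λ w → (rank c z ≟ⁿ rank c w) →-dec (z ≟ᴾ w)) grid) grid ×-dec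
    All.all? (λ (i , J) → sortedTop? _≟ᴾ_ (λ x y → rank c x <? rank c y) k (row i J) (map (i ,_) (table codes i J)))
      rowIntervals

  matrices : List Matrix
  matrices = vectors (vectors (upTo (suc (length grid))) n) m

  initial : Vec (List Bool) m → Pool
  initial codes = record
    { candidates = filter (consistent? codes) matrices
    ; injective  = λ c∈ → λ {z} {w} → All.lookup (All.lookup (proj₁ (consistent c∈)) (∈-grid z)) (∈-grid w)
    ; rows       = λ i J → map (i ,_) (table codes i J) ,
                           λ c∈ → All.lookup (proj₂ (consistent c∈)) (∈-rowIntervals i J)
    }
    where
    consistent : ∀ {c} → c ∈ filter (consistent? codes) matrices → Consistent codes c
    consistent = proj₂ ∘ ∈-filter⁻ (consistent? codes) {xs = matrices}

  row-sortedTop : ∀ {ℓ} {_≺_ : Rel (Fin n) ℓ} {L} c i J → (∀ {x y} → x ≺ y → (i , x) <[ c ] (i , y)) →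
                  SortedTop _≺_ k (columns J) L → Top c (row i J) (map (i ,_) L)
  row-sortedTop {L = L} c i J mono top = record
    { inside     = All.map⁺ (All.map (λ p∈ → ∈-region⁺ (i ∷ []) J (here refl) (∈-columns⁻ J p∈)) (inside top))
    ; size       = trans (length-map (i ,_) L) (trans (size top) (cong (k ⊓_) (sym
                     (trans (length-cartesianProduct (i ∷ []) (columns J)) (+-identityʳ _)))))
    ; largest    = largest′
    ; decreasing = AllPairs.map⁺ (AllPairs.map mono (decreasing top))
    }
    where
    open SortedTop
    largest′ : ∀ {z w} → z ∈ map (i ,_) L → w ∈ row i J → w ∉ map (i ,_) L → w <[ c ] z
    largest′ z∈ w∈ w∉ with ∈-map⁻ (i ,_) z∈ | ∈-region⁻ (i ∷ []) J w∈
    ... | p , p∈L , refl | here refl , q∈J = mono (largest top p∈L (∈-columns⁺ J q∈J) (w∉ ∘ ∈-map⁺ (i ,_)))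

  module _ (A : Array Pos) where

    _≺_ : Rel Pos _
    x ≺ y = value A x <ᴼ value A y

    ≺-irrefl : Irreflexive _≡_ _≺_
    ≺-irrefl refl = <ᴼ-irrefl ≈-refl

    ≺-total : ∀ {x y} → x ≢ y → x ≺ y ⊎ y ≺ x
    ≺-total {x} {y} x≢y = Sum.map (_, x≢y ∘ distinct A) (_, x≢y ∘ sym ∘ distinct A) (total (value A x) (value A y))

    -- `O` carries no decision procedure; `total` and the distinctness of the entries supply one.
    _≺?_ : ∀ x y → Dec (x ≺ y)
    x ≺? y with x ≟ᴾ y
    ... | yes x≡y = no (≺-irrefl x≡y)
    ... | no  x≢y = [ yes , (λ y≺x → no λ x≺y → <ᴼ-asym x≺y y≺x) ]′ (≺-total x≢y)

    open Ranking _≺?_ ≺-irrefl <ᴼ-trans ≺-total _≟ᴾ_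
      (unique-cartesianProduct⁺ (unique-allFin m) (unique-allFin n)) ∈-grid

    matrix : Matrix
    matrix = Vec.tabulate λ i → Vec.tabulate λ p → index (i , p)

    rank-matrix : ∀ z → rank matrix z ≡ index z
    rank-matrix (i , p) = trans (cong (λ r → Vec.lookup r p) (lookup∘tabulate (λ i → Vec.tabulate λ p → index (i , p)) i))
                                (lookup∘tabulate (λ p → index (i , p)) p)

    matrix-mono : ∀ {x y} → x ≺ y → x <[ matrix ] y
    matrix-mono {x} {y} x≺y = subst₂ _<_ (sym (rank-matrix x)) (sym (rank-matrix y)) (index-mono x≺y)

    matrix-reflects : ∀ {x y} → x <[ matrix ] y → x ≺ y
    matrix-reflects {x} {y} lt = index-reflects (subst₂ _<_ (rank-matrix x) (rank-matrix y) lt)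

    rowArray : Fin m → Array (Fin n)
    rowArray i = record { value = λ p → value A (i , p) ; distinct = cong proj₂ ∘ distinct A }

    codes : Vec (List Bool) m
    codes = Vec.tabulate (encode ∘ rowArray)

    table-correct : ∀ i J → SortedTop (λ p q → (i , p) ≺ (i , q)) k (columns J) (table codes i J)
    table-correct i (a , b) with a Fin.≤? b
    ... | no  a≰b = []-sortedTop Fin._≟_ (trans (cong (λ xs → k ⊓ length xs)
                      (no-members⇒[] λ p∈ → let (a≤p , p≤b) = ∈-columns⁻ (a , b) p∈ in a≰b (≤-trans a≤p p≤b)))
                      (⊓-zeroʳ k))
    ... | yes a≤b rewrite lookup∘tabulate (encode ∘ rowArray) i = record
      { inside = inside t ; size = size t ; largest = largest t ; decreasing = decreasing t }
      where
      open IsSortedTopK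
      t = correct (rowArray i) (a , b , a≤b)

    matrix∈initial : matrix ∈ Pool.candidates (initial codes)
    matrix∈initial = ∈-filter⁺ (consistent? codes)
      (∈-vectors (VecAll.tabulate⁺ λ i → ∈-vectors (VecAll.tabulate⁺ λ p → ∈-upTo⁺ (s≤s (index≤ (i , p))))))
      ( All.tabulate (λ {z} _ → All.tabulate λ {w} _ eq →
          index-injective (trans (sym (rank-matrix z)) (trans eq (rank-matrix w))))
      , All.tabulate (λ {(i , J)} _ → row-sortedTop matrix i J matrix-mono (table-correct i J)))

  F : ℕ
  F = length charges

  comparisons : Array Pos → List Bool
  comparisons A = emit F (initial (codes A)) (matrix A)

  length-comparisons : ∀ A → length (comparisons A) ≡ F
  length-comparisons A = length-emit F (initial (codes A)) (matrix A)

  -- The padded codes of the later rows come first, then the comparison bits, whose number `F` is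
  -- constant. The code of the first row is whatever follows and needs no padding.
  encode₂ : Array Pos → List Bool
  encode₂ A = pack (Vec.tail (codes A)) (comparisons A ++ Vec.head (codes A))

  split : List Bool → Vec (List Bool) m × List Bool
  split bs = let codes , rest = unpack m′ bs in drop F rest Vec.∷ codes , take F rest

  short-rows : ∀ A → VecAll Short (Vec.tail (codes A))
  short-rows A = VecAll.tabulate⁺ λ i → encode-length (rowArray A (Fin.suc i))

  split-encode₂ : ∀ A → split (encode₂ A) ≡ (codes A , comparisons A)
  split-encode₂ A
    rewrite unpack-pack (short-rows A) (comparisons A ++ Vec.head (codes A))
          | take-length-++ (comparisons A) {Vec.head (codes A)} (length-comparisons A)
          | drop-length-++ (comparisons A) {Vec.head (codes A)} (length-comparisons A) = refl

  final : Vec (List Bool) m × List Bool → Pool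
  final (codes , bits) = survive (initial codes) bits

  answer₂ : Vec (List Bool) m × List Bool → Range m × Range n → List Pos
  answer₂ state ((i , j , _) , (a , b , _)) =
    report (Pool.candidates (final state)) (Pool.injective (final state))
           (unique-region (unique-columns (i , j)) (a , b))

  decode₂ : List Bool → Range m × Range n → List Pos
  decode₂ bs = answer₂ (split bs)

  answer₂-correct : ∀ A x → IsSortedTopK k A (positions₂ x)
                      (answer₂ (codes A , comparisons A) x)
  answer₂-correct A ((i , j , _) , (a , b , _)) = record
    { inside = inside t ; size = size t ; largest = largest t ; decreasing = decreasing t }
    where
    open SortedTop
    P = final (codes A , comparisons A)
    matrix∈P = emit-survives F (initial (codes A)) (matrix∈initial A)
    resolved : AllResolved P
    -- No charge has been earned at the start, and there are as many bits as charges.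
    resolved = survivors-resolved charges ∈-charges (comparisons A) (initial (codes A)) [] [] (λ ()) (λ ())
                 (length-comparisons A)
    t : SortedTop (_≺_ A) k (region (columns (i , j)) (a , b)) _
    t = agree⇒same-top _≟ᴾ_ (λ _ _ → matrix-reflects A)
          (report-correct P resolved (columns (i , j)) (a , b) matrix∈P (unique-region (unique-columns (i , j)) (a , b)))

  length-encode₂ : ∀ A → length (encode₂ A) ≤ m * s + 2 * n * m * m′
  length-encode₂ A = begin
    length (encode₂ A)                                                ≡⟨ length-pack (short-rows A) _ ⟩
    m′ * suc s + length (bits ++ code₀)                               ≡⟨ cong (m′ * suc s +_) (length-++ bits) ⟩
    m′ * suc s + (length bits + length code₀)                         ≤⟨ +-monoʳ-≤ (m′ * suc s)
                                                                           (+-mono-≤ (≤-reflexive (trans (length-comparisons A) length-charges))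
                                                                                     (encode-length (rowArray A Fin.zero))) ⟩
    -- Padding costs `m′` bits and the first column saves `m * m′`, which leaves a surplus of
    -- `m′ * m′`.
    m′ * suc s + (m * (n * m′) + m * (n′ * m′) + s)                   ≤⟨ m≤m+n _ (m′ * m′) ⟩
    m′ * suc s + (m * (n * m′) + m * (n′ * m′) + s) + m′ * m′         ≡⟨ arithmetic m′ n′ s ⟩
    m * s + 2 * n * m * m′                                            ∎
    where
    open ≤-Reasoning
    bits code₀ : List Bool
    bits  = comparisons A
    code₀ = Vec.head (codes A)
    arithmetic : ∀ m n s → m * suc s + (suc m * (suc n * m) + suc m * (n * m) + s) + m * m
                           ≡ suc m * s + 2 * suc n * suc m * m
    arithmetic = solve-∀

  decode₂-correct : ∀ A x → IsSortedTopK k A (positions₂ x) (decode₂ (encode₂ A) x)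
  decode₂-correct A x = subst (IsSortedTopK k A (positions₂ x))
    (cong (λ state → answer₂ state x) {x = codes A , comparisons A} {y = split (encode₂ A)}
          (sym (split-encode₂ A)))
    (answer₂-correct A x)

  encoding₂ : SortedEncoding₂ m n k (m * s + 2 * n * m * m′)
  encoding₂ = record
    { encode        = encode₂
    ; encode-length = length-encode₂
    ; decode        = decode₂
    ; correct       = decode₂-correct
    }

-- From the construction to the stated bounds

sortedEncoding₂ : ∀ {c ℓ₁ ℓ₂} (O : TotalOrder c ℓ₁ ℓ₂) → let open TopK O in ∀ {m n k s} → m ≤ n →
                  SortedEncoding₁ n k s → SortedEncoding₂ m n k (m * s + 2 * n * m * (m ∸ 1))
sortedEncoding₂ O {zero} _ _ = record
  { encode = λ _ → [] ; encode-length = λ _ → z≤n ; decode = λ { _ ((() , _) , _) } ; correct = λ { _ ((() , _) , _) } }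
sortedEncoding₂ O {suc m} {suc n} _ E = Construction.encoding₂ O E

theorem7 : ∀ {c ℓ₁ ℓ₂} (O : TotalOrder c ℓ₁ ℓ₂) →
    let open TopK O in
    ((S : ℕ → ℕ → ℕ) (m n k : ℕ) → m ≤ n → 1 ≤ k →
    SortedEncoding₁ n k (S n k) →
    SortedEncoding₂ m n k (m * S n k + 2 * n * m * (m ∸ 1)))
    ×
    ((g : ℕ → ℕ) → IsLittleO-n g → (m : ℕ) →
    ∃ λ (h : ℕ → ℕ) → IsLittleO-n h ×
    ((n k : ℕ) → m ≤ n → 1 ≤ k →
    (∃ λ s → (s ≤ 1 ·lg (((k + 1) * n) C n) + g n) × SortedEncoding₁ n k s) →
    (∃ λ t → (t ≤ m ·lg (((k + 1) * n) C n) + (2 * n * m * (m ∸ 1) + h n)) × SortedEncoding₂ m n k t)))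
theorem7 O =
  (λ S m n k m≤n _ E → sortedEncoding₂ O m≤n E) ,
  -- Each of the `m` row encodings contributes a redundancy of `g n`.
  (λ g g=o m → (λ n → m * g n) , little-o g=o m , λ n k m≤n _ (s , s≤ , E) →
    m * s + 2 * n * m * (m ∸ 1) , bound (((k + 1) * n) C n) m (g n) (2 * n * m * (m ∸ 1)) s≤ , sortedEncoding₂ O m≤n E)
  where
  little-o : ∀ {g} → IsLittleO-n g → ∀ m → IsLittleO-n (λ n → m * g n)
  little-o g=o zero    d _   = 0 , λ n _ → ≤-trans (≤-reflexive (*-zeroʳ d)) z≤n
  little-o {g} g=o (suc m) d 1≤d with g=o (d * suc m) (*-mono-≤ 1≤d (s≤s z≤n))
  ... | N , small = N , λ n N≤n → ≤-trans (≤-reflexive (sym (*-assoc d (suc m) (g n)))) (small n N≤n)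

  ^-distribʳ-* : ∀ r x y → (x * y) ^ r ≡ x ^ r * y ^ r
  ^-distribʳ-* zero    x y = refl
  ^-distribʳ-* (suc r) x y = trans (cong (x * y *_) (^-distribʳ-* r x y)) ([m*n]*[o*p]≡[m*o]*[n*p] x y (x ^ r) (y ^ r))

  -- The `m`-th power of the hypothesis bounds `2 ^ (m * s)`; the factor `2 ^ e` accounts for the
  -- additional bits.
  bound : ∀ x m g e {s} → s ≤ 1 ·lg x + g → (m * s + e) ≤ m ·lg x + (e + m * g)
  bound x m g e {s} s≤ = begin
    2 ^ (m * s + e)                ≡⟨ ^-distribˡ-+-* 2 (m * s) e ⟩
    2 ^ (m * s) * 2 ^ e            ≡⟨ cong (λ t → 2 ^ t * 2 ^ e) (*-comm m s) ⟩
    2 ^ (s * m) * 2 ^ e            ≡⟨ cong (_* 2 ^ e) (^-*-assoc 2 s m) ⟨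
    (2 ^ s) ^ m * 2 ^ e            ≤⟨ *-monoˡ-≤ (2 ^ e) (^-monoˡ-≤ m s≤) ⟩
    (x ^ 1 * 2 ^ g) ^ m * 2 ^ e    ≡⟨ cong (λ y → (y * 2 ^ g) ^ m * 2 ^ e) (*-identityʳ x) ⟩
    (x * 2 ^ g) ^ m * 2 ^ e        ≡⟨ cong (_* 2 ^ e) (^-distribʳ-* m x (2 ^ g)) ⟩
    x ^ m * (2 ^ g) ^ m * 2 ^ e    ≡⟨ cong (λ y → x ^ m * y * 2 ^ e) (^-*-assoc 2 g m) ⟩
    x ^ m * 2 ^ (g * m) * 2 ^ e    ≡⟨ *-assoc (x ^ m) (2 ^ (g * m)) (2 ^ e) ⟩
    x ^ m * (2 ^ (g * m) * 2 ^ e)  ≡⟨ cong (x ^ m *_) (^-distribˡ-+-* 2 (g * m) e) ⟨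
    x ^ m * 2 ^ (g * m + e)        ≡⟨ cong (λ t → x ^ m * 2 ^ t) (trans (+-comm (g * m) e) (cong (e +_) (*-comm g m))) ⟩
    x ^ m * 2 ^ (e + m * g)        ∎
    where open ≤-Reasoning
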